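{- Let $m,n,p,q$ be natural numbers. If $p \geqslant 2q$ and $n \geqslant q+1$, then Maker has a winning strategy for the $(p,q)$-crossing game on $\Lambda_{m\times n}$.
   Context: $\Lambda_{m\times n}$ is the grid graph with vertex set $\{(x,y): x\in[m], y\in[n]\}$ (where $[k]=\{1,\dots,k\}$), two vertices being adjacent iff they are at Euclidean distance $1$; so each row has $m$ vertices and each column has $n$ vertices. A left-right crossing path is a path in the board joining some vertex $(1,y)$ to some vertex $(m,y')$. The $(p,q)$-crossing game on $\Lambda_{m\times n}$: two players, Maker and Breaker, alternate turns, Maker first. On each of her turns Maker claims $p$ as-yet unclaimed edges; on each of his turns Breaker claims $q$ as-yet unclaimed edges (destroying them). Maker wins if she claims all edges of some left-right crossing path; Breaker wins if the board reaches a state where Maker can never claim such a path. -}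

module Defs where

open import Data.Nat using (ℕ; zero; suc; _<_; _∸_; pred)
open import Data.Fin using (Fin; toℕ)
import Data.Fin as Fin
open import Data.Bool using (Bool; true; false; _∧_; _∨_; if_then_else_)
open import Data.List using (List; []; _∷_; length; head; last)
open import Data.List.Relation.Unary.All using (All)
open import Data.List.Relation.Unary.Unique.Propositional using (Unique)
open import Data.List.Relation.Unary.Linked using (Linked)
open import Data.List.Membership.Propositional using (_∈_)
open import Data.Maybe using (Maybe; just; nothing)
open import Data.Product using (Σ; ∃; ∃₂; _×_; _,_)
open import Data.Sum using (_⊎_)
open import Relation.Binary.PropositionalEquality using (_≡_)
open import Relation.Nullary.Decidable using (⌊_⌋)

-- Conventions: coordinates are 0-based, so the vertex (x,y) of the paper
-- (x ∈ [m], y ∈ [n]) is represented by (x-1 , y-1) with x-1 < m, y-1 < n.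
Vertex : Set
Vertex = ℕ × ℕ

data Edge (m n : ℕ) : Set where
  hor : Fin (pred m) → Fin n → Edge m n
  ver : Fin m → Fin (pred n) → Edge m n

ends : ∀ {m n} → Edge m n → Vertex × Vertex
ends (hor x y) = (toℕ x , toℕ y) , (suc (toℕ x) , toℕ y)
ends (ver x y) = (toℕ x , toℕ y) , (toℕ x , suc (toℕ y))

Joins : ∀ {m n} → Edge m n → Vertex → Vertex → Set
Joins e u v = ends e ≡ (u , v) ⊎ ends e ≡ (v , u)

StepIn : (m n : ℕ) → (Edge m n → Set) → Vertex → Vertex → Set
StepIn m n S u v = Σ (Edge m n) λ e → S e × Joins e u v

HasCrossingIn : (m n : ℕ) → (Edge m n → Set) → Set
HasCrossingIn m n S =
  Σ (List Vertex) λ vs → ∃₂ λ y y' →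
    y < n × y' < n ×
    head vs ≡ just (0 , y) ×
    last vs ≡ just (m ∸ 1 , y') ×
    Unique vs ×
    Linked (StepIn m n S) vs

data Owner : Set where
  free maker breaker : Owner

Board : ℕ → ℕ → Set
Board m n = Edge m n → Owner

_==E_ : ∀ {m n} → Edge m n → Edge m n → Bool
hor x y ==E hor x' y' = ⌊ x Fin.≟ x' ⌋ ∧ ⌊ y Fin.≟ y' ⌋
ver x y ==E ver x' y' = ⌊ x Fin.≟ x' ⌋ ∧ ⌊ y Fin.≟ y' ⌋
_ ==E _ = false

elemE : ∀ {m n} → Edge m n → List (Edge m n) → Bool
elemE e [] = false
elemE e (f ∷ fs) = (e ==E f) ∨ elemE e fs

claim : ∀ {m n} → Board m n → Owner → List (Edge m n) → Board m n
claim s o es e = if elemE e es then o else s e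

LegalMove : ∀ {m n} → Board m n → ℕ → List (Edge m n) → Set
LegalMove s k es =
  Unique es × All (λ e → s e ≡ free) es ×
  (length es ≡ k ⊎ (length es < k × (∀ e → s e ≡ free → e ∈ es)))

-- MakerWins m n p q s : in the (p,q)-crossing game on Λ_{m×n}, from board s
-- with Maker to move, Maker has a strategy that wins (claims all edges of a
-- left-right crossing path) after finitely many moves, whatever Breaker does.
data MakerWins (m n p q : ℕ) (s : Board m n) : Set where
  already : HasCrossingIn m n (λ e → s e ≡ maker) → MakerWins m n p q s
  play    : (es : List (Edge m n)) → LegalMove s p es →
            (HasCrossingIn m n (λ e → claim s maker es e ≡ maker)
             ⊎ ((bs : List (Edge m n)) → LegalMove (claim s maker es) q bs →
                MakerWins m n p q (claim (claim s maker es) breaker bs))) →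
            MakerWins m n p q s

emptyBoard : ∀ {m n} → Board m n
emptyBoard _ = free

MakerHasWinningStrategy : (m n p q : ℕ) → Set
MakerHasWinningStrategy m n p q = MakerWins m n p q emptyBoard

{-# OPTIONS --safe #-}
module Submission where

-- Breaker has to join the faces above the board to those below it by dual edges.  Maker keeps the faces partitioned
-- into clusters, each with a level, such that Breaker's edges stay inside clusters, the faces above the board have level 0,
-- those below it level n, an unclaimed dual edge changes the level by at most 1, and every cluster not touching the
-- bottom has at most four unclaimed exits: one leaving upwards in level, one leaving at constant level, and one entering
-- through a horizontal and one through a vertical edge.  When Breaker claims an edge, one of the two clusters it joins is
-- absorbed by the other; of its three further exits Maker keeps one, which replaces the exit used up at the absorbing
-- cluster, and claims the other two.  An exit to be claimed may be among Breaker's new edges, but then the claim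
-- saved pays for the third exit of the cluster absorbed through it.  The cluster of the bottom grows first, and as q < n it
-- cannot swallow a face above the board; every other group of joined clusters is absorbed by its lowest member.
-- On a full board the edges separating level 0 from the positive levels are therefore all Maker's, and counting them mod 2
-- between consecutive columns shows that they connect the left side to the right side.

open import Defs
open import Data.Nat
open import Data.Nat.Properties
open import Data.Nat.ListAction using (sum)
open import Algebra.Properties.CommutativeSemigroup +-commutativeSemigroup using (interchange)
open import Data.Bool using (Bool; true; false; if_then_else_; not; _xor_; _∧_)
import Data.Bool as Bool
open import Data.Bool.Properties using (∧-zeroʳ; xor-same)
open import Data.Bool.Solver using (module xor-∧-Solver)
open import Data.Empty using (⊥; ⊥-elim)
open import Data.Fin using (Fin; toℕ; fromℕ<)
import Data.Fin as Fin
open import Data.Fin.Properties using (toℕ-injective; toℕ-fromℕ<; toℕ<n) renaming (any? to anyFin?)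
open import Data.List using (List; []; _∷_; _++_; length; map; filter; take; allFin; cartesianProductWith)
import Data.List as List
open import Data.List.Extrema ≤-totalOrder using (argmin; argmin-all; f[argmin]≤f[xs])
open import Data.List.Membership.Propositional using (_∈_; _∉_; find; lose)
open import Data.List.Membership.Propositional.Properties
  using (∈-filter⁺; ∈-filter⁻; ∈-++⁺ˡ; ∈-++⁺ʳ; ∈-cartesianProductWith⁺; ∈-cartesianProductWith⁻; ∈-allFin)
open import Data.List.Properties using (length-take; take-all)
open import Data.List.Relation.Unary.All as All using (All; []; _∷_)
import Data.List.Relation.Unary.All.Properties as All
open import Data.List.Relation.Unary.AllPairs using ([]; _∷_)
open import Data.List.Relation.Unary.Any as Any using (Any; here; there; any?)
open import Data.List.Relation.Unary.Linked using (Linked; []; [-]; _∷_)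
open import Data.List.Relation.Unary.Unique.Propositional using (Unique)
import Data.List.Relation.Unary.Unique.Propositional.Properties as Unique
open import Data.Maybe using (just)
open import Data.Product using (Σ; ∃; ∃-syntax; _×_; _,_; proj₁; proj₂)
open import Data.Product.Properties using (≡-dec; ,-injectiveˡ; ,-injectiveʳ)
open import Data.Sum using (_⊎_; inj₁; inj₂; [_,_]′; swap)
open import Function using (_∘_; id)
open import Relation.Nullary
open import Relation.Nullary.Decidable
  using (_×-dec_; _⊎-dec_; ¬?; map′; dec-true; dec-false; ⌊_⌋; isYes≗does)
open import Relation.Unary using (Decidable)
open import Relation.Binary.Definitions using (DecidableEquality)
open import Relation.Binary.PropositionalEquality
open import Relation.Binary.Construct.Closure.ReflexiveTransitive using (Star; ε; _◅_; _◅◅_; reverse)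

-- Counting

sum-mono : ∀ {A : Set} {f g : A → ℕ} → (∀ x → f x ≤ g x) →
           ∀ xs → sum (map f xs) ≤ sum (map g xs)
sum-mono f≤g []       = z≤n
sum-mono f≤g (x ∷ xs) = +-mono-≤ (f≤g x) (sum-mono f≤g xs)

sum-+ : ∀ {A : Set} (f g : A → ℕ) xs →
        sum (map (λ x → f x + g x) xs) ≡ sum (map f xs) + sum (map g xs)
sum-+ f g []       = refl
sum-+ f g (x ∷ xs) = trans (cong (f x + g x +_) (sum-+ f g xs))
                           (interchange (f x) (g x) (sum (map f xs)) (sum (map g xs)))

sum-∈ : ∀ {A : Set} (f : A → ℕ) {x xs} → x ∈ xs → f x ≤ sum (map f xs)
sum-∈ f (here refl) = m≤m+n _ _
sum-∈ f (there x∈)  = m≤n⇒m≤o+n _ (sum-∈ f x∈)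

sum-≤0 : ∀ {A : Set} {f : A → ℕ} {xs} → All (λ x → f x ≡ 0) xs → sum (map f xs) ≤ 0
sum-≤0 []         = z≤n
sum-≤0 (eq ∷ eqs) = +-mono-≤ (≤-reflexive eq) (sum-≤0 eqs)

⟦_⟧ : ∀ {P : Set} → Dec P → ℕ
⟦ yes _ ⟧ = 1
⟦ no _  ⟧ = 0

⟦⟧-yes : ∀ {P : Set} (P? : Dec P) → P → 1 ≤ ⟦ P? ⟧
⟦⟧-yes (yes _) p = s≤s z≤n
⟦⟧-yes (no ¬p) p = ⊥-elim (¬p p)

⟦⟧-no : ∀ {P : Set} (P? : Dec P) → ¬ P → ⟦ P? ⟧ ≡ 0
⟦⟧-no (yes p) ¬p = ⊥-elim (¬p p)
⟦⟧-no (no _)  ¬p = refl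

⟦⟧-⇒ : ∀ {P Q : Set} (P? : Dec P) (Q? : Dec Q) → (P → Q) → ⟦ P? ⟧ ≤ ⟦ Q? ⟧
⟦⟧-⇒ (yes p) Q? f = ⟦⟧-yes Q? (f p)
⟦⟧-⇒ (no _)  Q? f = z≤n

count : ∀ {A : Set} {P : A → Set} → Decidable P → List A → ℕ
count P? xs = sum (map (λ x → ⟦ P? x ⟧) xs)

count-≤1 : ∀ {A : Set} {P : A → Set} (P? : Decidable P) {xs} → Unique xs →
           (∀ {x y} → P x → P y → x ≡ y) → count P? xs ≤ 1
count-≤1 P? [] p! = z≤n
count-≤1 P? (_∷_ {x} x∉ xs!) p! with P? x
... | no _   = count-≤1 P? xs! p!
... | yes px = s≤s (sum-≤0 (All.map (λ x≢ → ⟦⟧-no (P? _) (x≢ ∘ p! px)) x∉))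

count-⊎ : ∀ {A : Set} {P Q R : A → Set} (P? : Decidable P) (Q? : Decidable Q) (R? : Decidable R) →
          (∀ {x} → R x → P x ⊎ Q x) → ∀ xs → count R? xs ≤ count P? xs + count Q? xs
count-⊎ P? Q? R? R⇒ xs = ≤-trans (sum-mono pointwise xs) (≤-reflexive (sum-+ _ _ xs))
  where
  pointwise : ∀ x → ⟦ R? x ⟧ ≤ ⟦ P? x ⟧ + ⟦ Q? x ⟧
  pointwise x with R? x
  ... | no _ = z≤n
  ... | yes r with R⇒ r
  ...   | inj₁ p = ≤-trans (⟦⟧-yes (P? x) p) (m≤m+n _ _)
  ...   | inj₂ q = m≤n⇒m≤o+n _ (⟦⟧-yes (Q? x) q)

count-any : ∀ {A B : Set} {P : B → A → Set} (P? : ∀ b → Decidable (P b)) {xs} → Unique xs →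
            (∀ {b x y} → P b x → P b y → x ≡ y) →
            ∀ bs → count (λ x → any? (λ b → P? b x) bs) xs ≤ length bs
count-any P? {xs} xs! p! []       = sum-≤0 (All.universal (λ _ → refl) xs)
count-any P? {xs} xs! p! (b ∷ bs) =
  ≤-trans (count-⊎ (P? b) (λ x → any? (λ b → P? b x) bs) (λ x → any? (λ b → P? b x) (b ∷ bs)) Any.toSum xs)
          (+-mono-≤ (count-≤1 (P? b) xs! p!) (count-any P? xs! p! bs))

-- Merging one class of a labelling into another

module _ {V : Set} (_≟_ : DecidableEquality V) (c : V → V) (A R : V) where

  data Relabelled (v : V) : V → Set where
    moved : c v ≡ A → Relabelled v R
    kept  : c v ≢ A → Relabelled v (c v)

  abstract
    relabelled : ∀ v → ∃ (Relabelled v)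
    relabelled v with c v ≟ A
    ... | yes p = R , moved p
    ... | no ¬p = c v , kept ¬p

    relabel : V → V
    relabel = proj₁ ∘ relabelled

    relabel-view : ∀ v → Relabelled v (relabel v)
    relabel-view = proj₂ ∘ relabelled

  relabel-moved : ∀ {v} → c v ≡ A → relabel v ≡ R
  relabel-moved {v} p with relabel v | relabel-view v
  ... | _ | moved _ = refl
  ... | _ | kept ¬p = ⊥-elim (¬p p)

  relabel-kept : ∀ {v} → c v ≢ A → relabel v ≡ c v
  relabel-kept {v} ¬p with relabel v | relabel-view v
  ... | _ | moved p = ⊥-elim (¬p p)
  ... | _ | kept _  = refl

  relabel-cong : ∀ {v w} → c v ≡ c w → relabel v ≡ relabel w
  relabel-cong {v} {w} eq with relabel v | relabel-view v
  ... | _ | moved p = sym (relabel-moved (trans (sym eq) p))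
  ... | _ | kept ¬p = trans eq (sym (relabel-kept (¬p ∘ trans eq)))

-- Maker's reply

-- The states of an edge while Maker computes her reply: a new edge of Breaker is pending until the clusters at its ends
-- are merged, an owed edge is a pending one that Maker would otherwise have claimed, a chosen edge is part of her reply.
data Status : Set where
  unclaimed made cut chosen pending owed : Status

-- Two claims are available for each new edge of Breaker, and a third one if that edge is owed.
worth : Status → ℕ
worth chosen  = 1
worth pending = 2
worth owed    = 3
worth _       = 0

mark : Status → Status
mark unclaimed = chosen
mark pending   = owed
mark s         = s

-- A pending edge counts as still present: until the clusters at its ends are merged, it has a slope
-- and occupies a slot at each of them.
data Fresh : Status → Set where
  unclaimed : Fresh unclaimed
  pending   : Fresh pending

data Unsettled : Status → Set where
  pending : Unsettled pending
  owed    : Unsettled owed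

unsettled? : Decidable Unsettled
unsettled? pending   = yes pending
unsettled? owed      = yes owed
unsettled? unclaimed = no λ ()
unsettled? made      = no λ ()
unsettled? cut       = no λ ()
unsettled? chosen    = no λ ()

mark-fresh : ∀ {s} → ¬ Fresh (mark s)
mark-fresh {unclaimed} ()
mark-fresh {pending} ()
mark-fresh {made} ()
mark-fresh {cut} ()
mark-fresh {chosen} ()
mark-fresh {owed} ()

mark-cut : ∀ {s} → mark s ≡ cut → s ≡ cut
mark-cut {cut} _ = refl

mark-owed : ∀ {s} → mark s ≡ owed → Fresh s ⊎ s ≡ owed
mark-owed {pending} _ = inj₁ pending
mark-owed {owed}    _ = inj₂ refl

mark-unsettled : ∀ {s} → Unsettled (mark s) → Unsettled s
mark-unsettled {pending} _ = pending
mark-unsettled {owed}    _ = owed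

-- Marking a fresh edge costs exactly one claim, from 0 to 1 when it becomes `chosen` and from 2 to
-- 3 when it becomes `owed`; marking any other edge is free.
mark-worth : ∀ {P : Set} {s} (P? : Dec P) → (Fresh s → P) → worth (mark s) ≤ worth s + ⟦ P? ⟧
mark-worth {s = unclaimed} P? p = ⟦⟧-yes P? (p unclaimed)
mark-worth {s = pending}   P? p = +-monoʳ-≤ 2 (⟦⟧-yes P? (p pending))
mark-worth {s = made}      P? p = z≤n
mark-worth {s = cut}       P? p = z≤n
mark-worth {s = chosen}    P? p = m≤m+n 1 _
mark-worth {s = owed}      P? p = m≤m+n 3 _

owner : Status → Owner
owner unclaimed = free
owner chosen    = free
owner made      = maker
owner _         = breaker

mark-owner : ∀ s → owner (mark s) ≡ owner s
mark-owner unclaimed = refl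
mark-owner made      = refl
mark-owner cut       = refl
mark-owner chosen    = refl
mark-owner pending   = refl
mark-owner owed      = refl

unsettled-owner : ∀ {s} → Unsettled s → owner s ≡ breaker
unsettled-owner pending = refl
unsettled-owner owed    = refl

-- The exits of a cluster: tail true rises by one level, tail false keeps the level; head records whether the
-- entering edge is horizontal.
data Slot : Set where
  tail head : Bool → Slot

_≟S_ : DecidableEquality Slot
tail a ≟S tail b = map′ (cong tail) (λ { refl → refl }) (a Bool.≟ b)
head a ≟S head b = map′ (cong head) (λ { refl → refl }) (a Bool.≟ b)
tail a ≟S head b = no λ ()
head a ≟S tail b = no λ ()

head≢tail : ∀ {a b} → head a ≢ tail b
head≢tail ()

true≢false : tail true ≢ tail false
true≢false ()

-- Clusters of faces and their exits

module Response
  {E V : Set} (_≟E_ : DecidableEquality E) (_≟_ : DecidableEquality V)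
  (edges : List E) (edges! : Unique edges) (∈edges : ∀ e → e ∈ edges)
  (lo hi : E → V) (kind : E → Bool)
  (level : V → ℕ) (n : ℕ) (B : V) (level-B : level B ≡ n)
  (Source Sink : V → Set) where

  total : (E → ℕ) → ℕ
  total w = sum (map w edges)

  search : ∀ {P : E → Set} → Decidable P → ∃ P ⊎ (∀ e → ¬ P e)
  search P? with any? P? edges
  ... | yes p = let e , _ , pe = find p in inj₁ (e , pe)
  ... | no ¬p = inj₂ λ e pe → ¬p (lose (∈edges e) pe)

  -- An edge is typed at its `lo` end by `τ`, which merges may change, but at its `hi` end by
  -- `kind`, which is fixed.
  data At (c : V → V) (τ : E → Bool) (ℓ : V) (f : E) (σ : Slot) : Set where
    tailAt : c (lo f) ≡ ℓ → c (hi f) ≢ ℓ → tail (τ f) ≡ σ → At c τ ℓ f σ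
    headAt : c (hi f) ≡ ℓ → c (lo f) ≢ ℓ → head (kind f) ≡ σ → At c τ ℓ f σ

  at? : ∀ c τ ℓ f σ → Dec (At c τ ℓ f σ)
  at? c τ ℓ f σ = map′
    [ (λ (p , q , r) → tailAt p q r) , (λ (p , q , r) → headAt p q r) ]′
    (λ { (tailAt p q r) → inj₁ (p , q , r) ; (headAt p q r) → inj₂ (p , q , r) })
    ((c (lo f) ≟ ℓ ×-dec ¬? (c (hi f) ≟ ℓ) ×-dec tail (τ f) ≟S σ) ⊎-dec
     (c (hi f) ≟ ℓ ×-dec ¬? (c (lo f) ≟ ℓ) ×-dec head (kind f) ≟S σ))

  data Sloped (c : V → V) (τ : E → Bool) (f : E) : Set where
    inner : c (lo f) ≡ c (hi f) → Sloped c τ f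
    rise  : τ f ≡ true → level (c (hi f)) ≡ suc (level (c (lo f))) → Sloped c τ f
    flat  : τ f ≡ false → level (c (hi f)) ≡ level (c (lo f)) → Sloped c τ f
    -- A flat exit of a cluster that was absorbed by the bottom.
    hang  : c (lo f) ≡ B → suc (level (c (hi f))) ≡ n → Sloped c τ f

  -- The cluster R that is being grown may have owed exits in excess of its four slots.
  LiveAt : V → V → Status → Set
  LiveAt R ℓ s = Fresh s ⊎ (s ≡ owed × ℓ ≢ R)

  -- Clusters are named by faces: `c v` is the name of the cluster of `v`, and the level of the name
  -- is the level of the cluster. `R` names the growing cluster. By `credited` every owed edge ends
  -- there, so all owed edges are settled before another cluster starts to grow.
  record Layout (st : E → Status) (c : V → V) (τ : E → Bool) (R : V) : Set where
    field
      source   : ∀ {v} → Source v → level (c v) ≡ 0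
      sink     : ∀ {v} → Sink v → c v ≡ B
      bounded  : ∀ v → level (c v) ≤ n
      only-B   : ∀ v → level (c v) ≡ n → c v ≡ B
      joined   : ∀ {f} → st f ≡ cut → c (lo f) ≡ c (hi f)
      sloped   : ∀ {f} → Fresh (st f) → Sloped c τ f
      credited : ∀ {f} → st f ≡ owed → c (lo f) ≡ R ⊎ c (hi f) ≡ R
      unique   : ∀ {ℓ σ f g} → ℓ ≢ B → LiveAt R ℓ (st f) → LiveAt R ℓ (st g) →
                 At c τ ℓ f σ → At c τ ℓ g σ → f ≡ g

  -- Settling one edge, and the budget of claims

  module Update (st : E → Status) (e : E) (Marked : E → Set) (marked? : Decidable Marked) where

    data Updated (f : E) : Status → Set where
      settled : f ≡ e → Updated f cut
      marked  : f ≢ e → Marked f → Updated f (mark (st f))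
      same    : f ≢ e → ¬ Marked f → Updated f (st f)

    updated : ∀ f → ∃ (Updated f)
    updated f with f ≟E e | marked? f
    ... | yes p | _     = cut , settled p
    ... | no ¬p | yes m = mark (st f) , marked ¬p m
    ... | no ¬p | no ¬m = st f , same ¬p ¬m

    update : E → Status
    update = proj₁ ∘ updated

    view : ∀ f → Updated f (update f)
    view = proj₂ ∘ updated

    update-unsettled : ∀ {f} → Unsettled (update f) → Unsettled (st f)
    update-unsettled {f} u with update f | view f
    ... | _ | marked _ _ = mark-unsettled {st f} u
    ... | _ | same _ _   = u

    update-fresh : ∀ {f} → Fresh (update f) → f ≢ e × ¬ Marked f × Fresh (st f)
    update-fresh {f} u with update f | view f
    ... | _ | marked _ _ = ⊥-elim (mark-fresh {st f} u)
    ... | _ | same ≢ ¬m  = ≢ , ¬m , u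

    update-cut : ∀ {f} → update f ≡ cut → f ≡ e ⊎ st f ≡ cut
    update-cut {f} u with update f | view f
    ... | _ | settled p  = inj₁ p
    ... | _ | marked _ _ = inj₂ (mark-cut {st f} u)
    ... | _ | same _ _   = inj₂ u

    update-owed : ∀ {f} → update f ≡ owed → st f ≡ owed ⊎ (Fresh (st f) × Marked f)
    update-owed {f} u with update f | view f
    ... | _ | marked _ m = [ (λ fr → inj₂ (fr , m)) , inj₁ ]′ (mark-owed {st f} u)
    ... | _ | same _ _   = inj₁ u

    update-owner : Unsettled (st e) → ∀ f → owner (update f) ≡ owner (st f)
    update-owner u f with update f | view f
    ... | _ | settled refl = sym (unsettled-owner u)
    ... | _ | marked _ _   = mark-owner (st f)
    ... | _ | same _ _     = refl

  unsettled# : (E → Status) → ℕ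
  unsettled# st = count (unsettled? ∘ st) edges

  value : (E → Status) → ℕ
  value st = total (worth ∘ st)

  module Count (st : E → Status) (e : E) (u : Unsettled (st e))
               (Marked : E → Set) (marked? : Decidable Marked) where
    open Update st e Marked marked?

    fewer : suc (unsettled# update) ≤ unsettled# st
    fewer = begin
      suc (unsettled# update)                         ≡⟨ +-comm 1 _ ⟩
      unsettled# update + 1                           ≤⟨ +-monoʳ-≤ (unsettled# update) (≤-trans (⟦⟧-yes (e ≟E e) refl) (sum-∈ (λ f → ⟦ f ≟E e ⟧) (∈edges e))) ⟩
      unsettled# update + count (_≟E e) edges         ≡⟨ sum-+ _ _ edges ⟨
      total (λ f → ⟦ unsettled? (update f) ⟧ + ⟦ f ≟E e ⟧) ≤⟨ sum-mono pointwise edges ⟩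
      unsettled# st ∎
      where
      open ≤-Reasoning
      pointwise : ∀ f → ⟦ unsettled? (update f) ⟧ + ⟦ f ≟E e ⟧ ≤ ⟦ unsettled? (st f) ⟧
      pointwise f with f ≟E e
      ... | yes refl = ⟦⟧-yes (unsettled? (st f)) u
      ... | no  f≢e with marked? f
      ...   | yes m = ≤-trans (≤-reflexive (+-identityʳ _)) (⟦⟧-⇒ (unsettled? (mark (st f))) (unsettled? (st f)) (mark-unsettled {st f}))
      ...   | no ¬m = ≤-reflexive (+-identityʳ _)

    -- Settling `e` releases `worth (st e)`, and every other hit costs at most one. As `e` is itself
    -- a hit, one more hit than the released worth is affordable. Adding the weight `w` at `e` alone
    -- makes the comparison termwise.
    not-dearer : ∀ {Hit : E → Set} (hit? : Decidable Hit) →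
                 (∀ {f} → Fresh (st f) → Marked f → Hit f) → Hit e →
                 count hit? edges ≤ suc (worth (st e)) → value update ≤ value st
    not-dearer hit? m⇒h hit-e h# = +-cancelʳ-≤ w _ _ (begin
      value update + w                                   ≤⟨ +-monoʳ-≤ (value update) (≤-trans (≤-reflexive (sym (*-identityʳ w))) (≤-trans (*-monoʳ-≤ w (⟦⟧-yes (e ≟E e) refl)) (sum-∈ (λ f → w * ⟦ f ≟E e ⟧) (∈edges e)))) ⟩
      value update + total (λ f → w * ⟦ f ≟E e ⟧)        ≡⟨ sum-+ _ _ edges ⟨
      total (λ f → worth (update f) + w * ⟦ f ≟E e ⟧)    ≤⟨ sum-mono pointwise edges ⟩
      total (λ f → worth (st f) + ⟦ hit? f ⟧)            ≡⟨ sum-+ _ _ edges ⟩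
      value st + count hit? edges                        ≤⟨ +-monoʳ-≤ (value st) h# ⟩
      value st + w                                       ∎)
      where
      open ≤-Reasoning
      w : ℕ
      w = suc (worth (st e))
      pointwise : ∀ f → worth (update f) + w * ⟦ f ≟E e ⟧ ≤ worth (st f) + ⟦ hit? f ⟧
      pointwise f with f ≟E e
      ... | yes refl = ≤-trans (≤-reflexive (trans (*-identityʳ w) (+-comm 1 _))) (+-monoʳ-≤ (worth (st e)) (⟦⟧-yes (hit? e) hit-e))
      ... | no  f≢e with marked? f
      ...   | yes m = ≤-trans (≤-reflexive (trans (cong (worth (mark (st f)) +_) (*-zeroʳ w)) (+-identityʳ _))) (mark-worth (hit? f) (λ fr → m⇒h fr m))
      ...   | no ¬m = ≤-trans (≤-reflexive (trans (cong (worth (st f) +_) (*-zeroʳ w)) (+-identityʳ _))) (m≤m+n _ _)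

  -- Absorbing the cluster A into the cluster R

  module Merge (st : E → Status) (c : V → V) (τ : E → Bool) (R A : V) (t : Bool)
               (drops : List Slot) (e : E) where

    Dropped : E → Set
    Dropped f = Any (At c τ A f) drops

    dropped? : Decidable Dropped
    dropped? f = any? (at? c τ A f) drops

    open Update st e Dropped dropped? public

    c′ : V → V
    c′ = relabel _≟_ c A R

    -- A single type `t` serves for all of `A`, since each merge below keeps the exits of at most
    -- one slot.
    τ′ : E → Bool
    τ′ f = if does (c (lo f) ≟ A) then t else τ f

    τ′-moved : ∀ {f} → c (lo f) ≡ A → τ′ f ≡ t
    τ′-moved {f} p with c (lo f) ≟ A
    ... | yes _ = refl
    ... | no ¬p = ⊥-elim (¬p p)

    τ′-kept : ∀ {f} → c (lo f) ≢ A → τ′ f ≡ τ f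
    τ′-kept {f} ¬p with c (lo f) ≟ A
    ... | yes p = ⊥-elim (¬p p)
    ... | no _  = refl

    moved′ : ∀ {v} → c v ≡ A → c′ v ≡ R
    moved′ = relabel-moved _≟_ c A R

    kept′ : ∀ {v} → c v ≢ A → c′ v ≡ c v
    kept′ = relabel-kept _≟_ c A R

    -- What remains to be checked for each kind of merge: `source-ok` protects the faces above the
    -- board, the slot of `e` is among those dropped, and an exit kept from `A` has a valid slope at
    -- its new cluster and does not share a slot with a fresh exit of `R`. The last condition is
    -- void at the bottom, whose exits are not limited.
    module Correct
      (L : Layout st c τ R)
      (e-unsettled : Unsettled (st e))
      (R-label : ∃[ v ] c v ≡ R) (A≢R : A ≢ R) (A≢B : A ≢ B)
      (source-ok : level A ≡ 0 → level R ≡ 0)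
      (e-ends : (c (lo e) ≡ R × c (hi e) ≡ A) ⊎ (c (lo e) ≡ A × c (hi e) ≡ R))
      (e-dropped : Dropped e)
      (drops# : length drops ≤ suc (worth (st e)))
      (keep-slope : ∀ {f σ} → Fresh (st f) → At c τ A f σ → σ ∉ drops →
                    c′ (lo f) ≢ c′ (hi f) → Sloped c′ τ′ f)
      (keep-one : ∀ {σ ρ} → σ ∉ drops → ρ ∉ drops → σ ≡ ρ)
      (keep-unique : ∀ {f g σ ρ} → R ≢ B → Fresh (st f) → Fresh (st g) →
                     At c τ R f ρ → At c′ τ′ R f ρ →
                     At c τ A g σ → At c′ τ′ R g ρ → σ ∉ drops → f ≡ g)
      where

      open Layout L
      open Count st e e-unsettled Dropped dropped? public using (fewer)
      open Count st e e-unsettled Dropped dropped? using (not-dearer)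

      -- Each slot of `A` holds at most one live edge, so there are at most `length drops` hits.
      -- Owed edges are live at `A` because `A` differs from `R`.
      cheap : value update ≤ value st
      cheap = not-dearer hit? (λ fr → Any.map (λ a → inj₁ fr , a))
        (Any.map (live (st e) e-unsettled ,_) e-dropped)
        (≤-trans (count-any hit₁? edges! (λ (l , a) (l₁ , a₁) → unique A≢B l l₁ a a₁) drops) drops#)
        where
        live : ∀ s → Unsettled s → LiveAt R A s
        live _ pending = inj₁ pending
        live _ owed    = inj₂ (refl , A≢R)
        Hit₁ : Slot → E → Set
        Hit₁ σ f = LiveAt R A (st f) × At c τ A f σ
        status-live? : ∀ s → Dec (LiveAt R A s)
        status-live? unclaimed = yes (inj₁ unclaimed)
        status-live? pending   = yes (inj₁ pending)
        status-live? owed      = yes (inj₂ (refl , A≢R))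
        status-live? made      = no λ { (inj₁ ()) ; (inj₂ ()) }
        status-live? cut       = no λ { (inj₁ ()) ; (inj₂ ()) }
        status-live? chosen    = no λ { (inj₁ ()) ; (inj₂ ()) }
        hit₁? : ∀ σ → Decidable (Hit₁ σ)
        hit₁? σ f = status-live? (st f) ×-dec at? c τ A f σ
        hit? : Decidable (λ f → Any (λ σ → Hit₁ σ f) drops)
        hit? f = any? (λ σ → hit₁? σ f) drops

      At-elsewhere : ∀ {ℓ f σ} → ℓ ≢ R → At c′ τ′ ℓ f σ → At c τ ℓ f σ
      At-elsewhere {f = f} ℓ≢R (tailAt p q r) with c (lo f) ≟ A
      ... | yes a = ⊥-elim (ℓ≢R (trans (sym p) (moved′ a)))
      ... | no ¬a = tailAt p₁ (λ z → q (trans (kept′ (λ a → ¬a (trans p₁ (trans (sym z) a)))) z)) r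
        where p₁ = trans (sym (kept′ ¬a)) p
      At-elsewhere {f = f} ℓ≢R (headAt p q r) with c (hi f) ≟ A
      ... | yes a = ⊥-elim (ℓ≢R (trans (sym p) (moved′ a)))
      ... | no ¬a = headAt p₁ (λ z → q (trans (kept′ (λ a → ¬a (trans p₁ (trans (sym z) a)))) z)) r
        where p₁ = trans (sym (kept′ ¬a)) p

      At-root : ∀ {f σ} → At c′ τ′ R f σ → At c τ R f σ ⊎ ∃[ ρ ] At c τ A f ρ
      At-root {f} (tailAt p q r) with c (lo f) ≟ A
      ... | yes a = inj₂ (_ , tailAt a (q ∘ moved′) refl)
      ... | no ¬a = inj₁ (tailAt (trans (sym (kept′ ¬a)) p)
                                 (λ z → q (trans (kept′ (λ a → A≢R (trans (sym a) z))) z)) r)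
      At-root {f} (headAt p q r) with c (hi f) ≟ A
      ... | yes a = inj₂ (_ , headAt a (q ∘ moved′) refl)
      ... | no ¬a = inj₁ (headAt (trans (sym (kept′ ¬a)) p)
                                 (λ z → q (trans (kept′ (λ a → A≢R (trans (sym a) z))) z)) r)

      avoids : ∀ {f σ} → ¬ Dropped f → At c τ A f σ → σ ∉ drops
      avoids ¬d a σ∈ = ¬d (lose σ∈ a)

      level-R : level R ≤ n
      level-R = let v , eq = R-label in subst (λ ℓ → level ℓ ≤ n) eq (bounded v)

      only-B-R : level R ≡ n → R ≡ B
      only-B-R r = let v , eq = R-label in trans (sym eq) (only-B v (trans (cong level eq) r))

      A-end : ∀ {f σ} → At c τ A f σ → c (lo f) ≡ A ⊎ c (hi f) ≡ A
      A-end (tailAt p _ _) = inj₁ p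
      A-end (headAt p _ _) = inj₂ p

      source′ : ∀ {v} → Source v → level (c′ v) ≡ 0
      source′ {v} s with c′ v | relabel-view _≟_ c A R v
      ... | _ | moved p = source-ok (trans (cong level (sym p)) (source s))
      ... | _ | kept _  = source s

      sink′ : ∀ {v} → Sink v → c′ v ≡ B
      sink′ {v} s = trans (kept′ λ p → A≢B (trans (sym p) (sink s))) (sink s)

      bounded′ : ∀ v → level (c′ v) ≤ n
      bounded′ v with c′ v | relabel-view _≟_ c A R v
      ... | _ | moved _ = level-R
      ... | _ | kept _  = bounded v

      only-B′ : ∀ v → level (c′ v) ≡ n → c′ v ≡ B
      only-B′ v with c′ v | relabel-view _≟_ c A R v
      ... | _ | moved _ = only-B-R
      ... | _ | kept _  = only-B v

      still : ∀ {v} → c v ≡ R → c′ v ≡ R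
      still p = trans (kept′ (λ a → A≢R (trans (sym a) p))) p

      e-joined : c′ (lo e) ≡ c′ (hi e)
      e-joined = [ (λ (p , q) → trans (still p) (sym (moved′ q)))
                 , (λ (p , q) → trans (moved′ p) (sym (still q))) ]′ e-ends

      joined′ : ∀ {f} → update f ≡ cut → c′ (lo f) ≡ c′ (hi f)
      joined′ u with update-cut u
      ... | inj₁ refl = e-joined
      ... | inj₂ s    = relabel-cong _≟_ c A R (joined s)

      sloped′ : ∀ {f} → Fresh (update f) → Sloped c′ τ′ f
      sloped′ {f} u = go (update-fresh u)
        where
        go : f ≢ e × ¬ Dropped f × Fresh (st f) → Sloped c′ τ′ f
        go (_ , ¬d , fr) with c′ (lo f) ≟ c′ (hi f)
        ... | yes eq = inner eq
        ... | no ≢ with c (lo f) ≟ A | c (hi f) ≟ A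
        ...   | yes a | _     = keep-slope fr at (avoids ¬d at) ≢
                where at = tailAt a (λ b → ≢ (relabel-cong _≟_ c A R (trans a (sym b)))) refl
        ...   | no _  | yes b = keep-slope fr at (avoids ¬d at) ≢
                where at = headAt b (λ a → ≢ (relabel-cong _≟_ c A R (trans a (sym b)))) refl
        ...   | no ¬a | no ¬b with sloped fr
        ...     | inner eq = ⊥-elim (≢ (relabel-cong _≟_ c A R eq))
        ...     | rise p q = rise (trans (τ′-kept ¬a) p)
                               (trans (cong level (kept′ ¬b)) (trans q (cong (suc ∘ level) (sym (kept′ ¬a)))))
        ...     | flat p q = flat (trans (τ′-kept ¬a) p)
                               (trans (cong level (kept′ ¬b)) (trans q (cong level (sym (kept′ ¬a)))))
        ...     | hang p q = hang (trans (kept′ ¬a) p) (trans (cong (suc ∘ level) (kept′ ¬b)) q)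

      credited′ : ∀ {f} → update f ≡ owed → c′ (lo f) ≡ R ⊎ c′ (hi f) ≡ R
      credited′ u with update-owed u
      ... | inj₁ s = [ (λ p → inj₁ (still p)) , (λ p → inj₂ (still p)) ]′ (credited s)
      ... | inj₂ (_ , d) = let _ , _ , a = find d in [ (λ p → inj₁ (moved′ p)) , (λ p → inj₂ (moved′ p)) ]′ (A-end a)

      -- A newly owed edge was fresh before, hence already live at its far end. It keeps its slot
      -- there, so that the cluster absorbed through it still has at most three other exits.
      live-elsewhere : ∀ {ℓ f} → ℓ ≢ R → LiveAt R ℓ (update f) → LiveAt R ℓ (st f)
      live-elsewhere ℓ≢R (inj₁ fr) = let _ , _ , fr₀ = update-fresh fr in inj₁ fr₀
      live-elsewhere ℓ≢R (inj₂ (o , _)) with update-owed o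
      ... | inj₁ s        = inj₂ (s , ℓ≢R)
      ... | inj₂ (fr , _) = inj₁ fr

      unique-root : ∀ {f g σ} → R ≢ B → Fresh (update f) → Fresh (update g) →
                    At c′ τ′ R f σ → At c′ τ′ R g σ → f ≡ g
      unique-root {f} {g} {σ} R≢B uf ug a′ b′ =
        go (update-fresh uf) (update-fresh ug) (At-root a′) (At-root b′)
        where
        go : f ≢ e × ¬ Dropped f × Fresh (st f) → g ≢ e × ¬ Dropped g × Fresh (st g) →
             At c τ R f σ ⊎ (∃[ ρ ] At c τ A f ρ) → At c τ R g σ ⊎ (∃[ ρ ] At c τ A g ρ) → f ≡ g
        go (_ , _ , ff) (_ , _ , fg) (inj₁ a) (inj₁ b) = unique R≢B (inj₁ ff) (inj₁ fg) a b
        go (_ , _ , ff) (_ , ¬d , fg) (inj₁ a) (inj₂ (_ , b)) =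
          keep-unique R≢B ff fg a a′ b b′ (avoids ¬d b)
        go (_ , ¬d , ff) (_ , _ , fg) (inj₂ (_ , a)) (inj₁ b) =
          sym (keep-unique R≢B fg ff b b′ a a′ (avoids ¬d a))
        -- Both exits come from `A`. Only one slot of `A` is kept, so they already shared a slot
        -- before retyping.
        go (_ , ¬df , ff) (_ , ¬dg , fg) (inj₂ (ρ , a)) (inj₂ (ρ₁ , b)) =
          unique A≢B (inj₁ ff) (inj₁ fg) a
            (subst (At c τ A g) (keep-one (avoids ¬dg b) (avoids ¬df a)) b)

      unique′ : ∀ {ℓ σ f g} → ℓ ≢ B → LiveAt R ℓ (update f) → LiveAt R ℓ (update g) →
                At c′ τ′ ℓ f σ → At c′ τ′ ℓ g σ → f ≡ g
      unique′ {ℓ} {σ} {f} {g} ℓ≢B lf lg a b with ℓ ≟ R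
      ... | no ℓ≢R = unique ℓ≢B (live-elsewhere {f = f} ℓ≢R lf) (live-elsewhere {f = g} ℓ≢R lg)
                       (At-elsewhere ℓ≢R a) (At-elsewhere ℓ≢R b)
      ... | yes refl with lf | lg
      ...   | inj₁ ff       | inj₁ fg       = unique-root ℓ≢B ff fg a b
      ...   | inj₂ (_ , ne) | _             = ⊥-elim (ne refl)
      ...   | inj₁ _        | inj₂ (_ , ne) = ⊥-elim (ne refl)

      layout′ : Layout update c′ τ′ R
      layout′ = record
        { source = source′ ; sink = sink′ ; bounded = bounded′ ; only-B = only-B′
        ; joined = joined′ ; sloped = sloped′ ; credited = credited′ ; unique = unique′ }

  at-crossing : ∀ {c τ ℓ f σ} → At c τ ℓ f σ → c (lo f) ≢ c (hi f)
  at-crossing (tailAt p q _) eq = q (trans (sym eq) p)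
  at-crossing (headAt p q _) eq = q (trans eq p)

  record Advance (st st′ : E → Status) : Set where
    constructor advance
    field
      fewer    : suc (unsettled# st′) ≤ unsettled# st
      cheap    : value st′ ≤ value st
      faithful : ∀ f → owner (st′ f) ≡ owner (st f)

  module Settle {st c τ R} (L : Layout st c τ R) (e : E) (u : Unsettled (st e))
                (e-inner : c (lo e) ≡ c (hi e)) where
    open Layout L
    open Update st e (λ _ → ⊥) (λ _ → no λ ()) public
    open Count st e u (λ _ → ⊥) (λ _ → no λ ()) using (fewer)

    cheap : value update ≤ value st
    cheap = sum-mono pointwise edges
      where
      pointwise : ∀ f → worth (update f) ≤ worth (st f)
      pointwise f with update f | view f
      ... | _ | settled _ = z≤n
      ... | _ | same _ _  = ≤-refl

    advances : Advance st update
    advances = advance fewer cheap (update-owner u)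

    still-owed : ∀ {f} → update f ≡ owed → st f ≡ owed
    still-owed o with update-owed o
    ... | inj₁ s = s

    layout : Layout update c τ R
    layout = record
      { source = source ; sink = sink ; bounded = bounded ; only-B = only-B
      ; joined = λ k → [ (λ { refl → e-inner }) , joined ]′ (update-cut k)
      ; sloped = λ fr → let _ , _ , fr₀ = update-fresh fr in sloped fr₀
      ; credited = credited ∘ still-owed
      ; unique = λ {_} {_} {f} {g} ℓ≢B l₁ l₂ → unique ℓ≢B (live f l₁) (live g l₂) }
      where
      live : ∀ {ℓ} f → LiveAt R ℓ (update f) → LiveAt R ℓ (st f)
      live f (inj₁ fr)      = let _ , _ , fr₀ = update-fresh fr in inj₁ fr₀
      live f (inj₂ (o , ne)) = inj₂ (still-owed o , ne)

  -- A layout constrains only cut, fresh and owed edges, so it survives when the first two sets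
  -- shrink and the third is empty. `R` matters for owed edges alone, so it may then be exchanged.
  transfer : ∀ {st st′ c τ R R′} → (∀ {f} → st′ f ≡ cut → st f ≡ cut) →
             (∀ {f} → Fresh (st′ f) → Fresh (st f)) → (∀ {f} → st′ f ≢ owed) →
             Layout st c τ R → Layout st′ c τ R′
  transfer {st} {st′} still-cut still-fresh no-owed L = record
    { source = source ; sink = sink ; bounded = bounded ; only-B = only-B
    ; joined = joined ∘ still-cut ; sloped = sloped ∘ still-fresh
    ; credited = λ o → ⊥-elim (no-owed o)
    ; unique = λ {_} {_} {f} {g} ℓ≢B l₁ l₂ → unique ℓ≢B (live f l₁) (live g l₂) }
    where
    open Layout L
    live : ∀ {R R′ ℓ} f → LiveAt R′ ℓ (st′ f) → LiveAt R ℓ (st f)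
    live f (inj₁ fr)      = inj₁ (still-fresh fr)
    live f (inj₂ (o , _)) = ⊥-elim (no-owed o)

  -- The kinds of merges

  all-slots : List Slot
  all-slots = tail true ∷ tail false ∷ head true ∷ head false ∷ []

  ∈all-slots : ∀ σ → σ ∈ all-slots
  ∈all-slots (tail true)  = here refl
  ∈all-slots (tail false) = there (here refl)
  ∈all-slots (head true)  = there (there (here refl))
  ∈all-slots (head false) = there (there (there (here refl)))

  all-but-flat : List Slot
  all-but-flat = tail true ∷ head true ∷ head false ∷ []

  head∈all-but-flat : ∀ b → head b ∈ all-but-flat
  head∈all-but-flat true  = there (here refl)
  head∈all-but-flat false = there (there (here refl))

  ∉all-but-flat : ∀ {σ} → σ ∉ all-but-flat → σ ≡ tail false
  ∉all-but-flat {tail true}  ∉ = ⊥-elim (∉ (here refl))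
  ∉all-but-flat {tail false} ∉ = refl
  ∉all-but-flat {head b}     ∉ = ⊥-elim (∉ (head∈all-but-flat b))

  all-but-head : Bool → List Slot
  all-but-head b = tail true ∷ tail false ∷ head (not b) ∷ []

  tail∈all-but-head : ∀ {b} a → tail a ∈ all-but-head b
  tail∈all-but-head true  = here refl
  tail∈all-but-head false = there (here refl)

  ∉all-but-head : ∀ {b σ} → σ ∉ all-but-head b → σ ≡ head b
  ∉all-but-head {b}     {tail a}     ∉ = ⊥-elim (∉ (tail∈all-but-head a))
  ∉all-but-head {true}  {head true}  ∉ = refl
  ∉all-but-head {true}  {head false} ∉ = ⊥-elim (∉ (there (there (here refl))))
  ∉all-but-head {false} {head true}  ∉ = ⊥-elim (∉ (there (there (here refl))))
  ∉all-but-head {false} {head false} ∉ = refl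

  module _ {st c τ R} (L : Layout st c τ R) {f} (slope : Sloped c τ f) (cross : c (lo f) ≢ c (hi f)) where
    open Layout L

    -- The bottom has the maximal level, so no edge rises from it; a flat one would end at level
    -- `n`, hence in the bottom itself. Only a hanging exit remains.
    over-sink : c (lo f) ≡ B → suc (level (c (hi f))) ≡ n
    over-sink p = go slope
      where
      go : Sloped c τ f → suc (level (c (hi f))) ≡ n
      go (inner eq) = ⊥-elim (cross eq)
      go (rise _ y) = ⊥-elim (1+n≰n (subst (_≤ n) (trans y (cong suc (trans (cong level p) level-B))) (bounded (hi f))))
      go (flat _ y) = ⊥-elim (cross (trans p (sym (only-B (hi f) (trans y (trans (cong level p) level-B))))))
      go (hang _ y) = y

    under-sink : c (hi f) ≡ B → suc (level (c (lo f))) ≡ n × τ f ≡ true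
    under-sink q = go slope
      where
      go : Sloped c τ f → suc (level (c (lo f))) ≡ n × τ f ≡ true
      go (inner eq) = ⊥-elim (cross eq)
      go (rise x y) = trans (sym y) (trans (cong level q) level-B) , x
      go (flat _ y) = ⊥-elim (cross (trans (only-B (lo f) (trans (sym y) (trans (cong level q) level-B))) (sym q)))
      go (hang x _) = ⊥-elim (cross (trans x (sym q)))

  record Step (st : E → Status) (c : V → V) (τ : E → Bool) (R A : V) (e : E) : Set where
    field
      t     : Bool
      drops : List Slot
    open Merge st c τ R A t drops e public
    field
      layout   : Layout update c′ τ′ R
      advances : Advance st update

  module Merging {st c τ R} (L : Layout st c τ R) (A : V) (e : E)
                 (R-label : ∃[ v ] c v ≡ R) (A≢R : A ≢ R) (A≢B : A ≢ B)
                 (source-ok : level A ≡ 0 → level R ≡ 0) where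
    open Layout L

    Ends : Set
    Ends = (c (lo e) ≡ R × c (hi e) ≡ A) ⊎ (c (lo e) ≡ A × c (hi e) ≡ R)

    merge-owed : st e ≡ owed → Ends → Step st c τ R A e
    merge-owed o ends = record
      { t = false ; drops = all-slots
      ; layout = layout′ ; advances = advance fewer cheap (update-owner e-unsettled) }
      where
      e-unsettled : Unsettled (st e)
      e-unsettled = subst Unsettled (sym o) owed
      open Merge st c τ R A false all-slots e
      e-at : ∃ (At c τ A e)
      e-at = [ (λ (p , q) → _ , headAt q (λ z → A≢R (trans (sym z) p)) refl)
             , (λ (p , q) → _ , tailAt p (λ z → A≢R (trans (sym z) q)) refl) ]′ ends
      open Correct L e-unsettled R-label A≢R A≢B source-ok ends
        (lose (∈all-slots _) (proj₂ e-at)) (≤-reflexive (cong (suc ∘ worth) (sym o)))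
        (λ {_} {σ} _ _ ∉ → ⊥-elim (∉ (∈all-slots σ)))
        (λ {σ} ∉ → ⊥-elim (∉ (∈all-slots σ)))
        (λ {_} {_} {σ} _ _ _ _ _ _ _ ∉ → ⊥-elim (∉ (∈all-slots σ)))

    module _ (pn : st e ≡ pending) where

      e-unsettled : Unsettled (st e)
      e-unsettled = subst Unsettled (sym pn) pending

      e-fresh : Fresh (st e)
      e-fresh = subst Fresh (sym pn) pending

      three : 3 ≤ suc (worth (st e))
      three = ≤-reflexive (cong (suc ∘ worth) (sym pn))

      -- Retyping the flat exit of A as τ e puts it in the slot that e occupied at R, with the right slope at level R.
      merge-up : R ≢ B → c (lo e) ≡ R → c (hi e) ≡ A → Step st c τ R A e
      merge-up R≢B p q = record
        { t = τ e ; drops = all-but-flat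
        ; layout = layout′ ; advances = advance fewer cheap (update-owner e-unsettled) }
        where
        open Merge st c τ R A (τ e) all-but-flat e
        hi≢R : c (hi e) ≢ R
        hi≢R z = A≢R (trans (sym q) z)
        lo≢A : c (lo e) ≢ A
        lo≢A z = A≢R (trans (sym z) p)
        keep-slope : ∀ {f σ} → Fresh (st f) → At c τ A f σ → σ ∉ all-but-flat →
                     c′ (lo f) ≢ c′ (hi f) → Sloped c′ τ′ f
        keep-slope fr (headAt _ _ r) ∉ _ = ⊥-elim (head≢tail (trans r (∉all-but-flat ∉)))
        keep-slope fr (tailAt a b r) ∉ _ with trans r (∉all-but-flat ∉) | sloped fr
        ... | r′ | inner eq = ⊥-elim (b (trans (sym eq) a))
        ... | r′ | rise x _ = ⊥-elim (true≢false (trans (cong tail (sym x)) r′))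
        ... | r′ | hang x _ = ⊥-elim (A≢B (trans (sym a) x))
        ... | r′ | flat _ y with sloped e-fresh
        ...   | inner eq = ⊥-elim (hi≢R (trans (sym eq) p))
        ...   | hang x _ = ⊥-elim (R≢B (trans (sym p) x))
        ...   | rise x z = rise (trans (τ′-moved a) x) (begin
                level (c′ (hi _))       ≡⟨ cong level (kept′ b) ⟩
                level (c (hi _))        ≡⟨ y ⟩
                level (c (lo _))        ≡⟨ cong level (trans a (sym q)) ⟩
                level (c (hi e))        ≡⟨ z ⟩
                suc (level (c (lo e)))  ≡⟨ cong (suc ∘ level) (trans p (sym (moved′ a))) ⟩
                suc (level (c′ (lo _))) ∎)
                where open ≡-Reasoning
        ...   | flat x z = flat (trans (τ′-moved a) x) (begin
                level (c′ (hi _))       ≡⟨ cong level (kept′ b) ⟩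
                level (c (hi _))        ≡⟨ y ⟩
                level (c (lo _))        ≡⟨ cong level (trans a (sym q)) ⟩
                level (c (hi e))        ≡⟨ z ⟩
                level (c (lo e))        ≡⟨ cong level (trans p (sym (moved′ a))) ⟩
                level (c′ (lo _))       ∎)
                where open ≡-Reasoning
        joined-e : c′ (lo e) ≡ c′ (hi e)
        joined-e = trans (trans (kept′ lo≢A) p) (sym (moved′ q))
        keep-unique : ∀ {f g σ ρ} → R ≢ B → Fresh (st f) → Fresh (st g) →
                      At c τ R f ρ → At c′ τ′ R f ρ →
                      At c τ A g σ → At c′ τ′ R g ρ → σ ∉ all-but-flat → f ≡ g
        keep-unique _ ff fg a a′ (headAt _ _ r) b′ ∉ = ⊥-elim (head≢tail (trans r (∉all-but-flat ∉)))
        keep-unique _ ff fg a a′ (tailAt x _ _) (headAt _ y _) ∉ = ⊥-elim (y (moved′ x))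
        -- The retyped exit `g` has the slot that `e` had at `R`. An old exit `f` of `R` in this
        -- slot could only be `e`, which now lies inside the merged cluster.
        keep-unique _ ff fg a a′ (tailAt x _ _) (tailAt _ _ r) ∉
          with unique R≢B (inj₁ ff) (inj₁ e-fresh) a
                 (tailAt p hi≢R (trans (cong tail (sym (τ′-moved x))) r))
        ... | refl = ⊥-elim (at-crossing a′ joined-e)
        open Correct L e-unsettled R-label A≢R A≢B source-ok (inj₁ (p , q))
          (lose (head∈all-but-flat _) (headAt q lo≢A refl)) three
          keep-slope (λ ∉ ∉′ → trans (∉all-but-flat ∉) (sym (∉all-but-flat ∉′))) keep-unique

      -- As level R is minimal, e is flat; the exit of A in the slot of e at R takes over that slot.
      merge-down : R ≢ B → level R ≤ level A → c (lo e) ≡ A → c (hi e) ≡ R → Step st c τ R A e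
      merge-down R≢B R≤A p q = record
        { t = τ e ; drops = all-but-head (kind e)
        ; layout = layout′ ; advances = advance fewer cheap (update-owner e-unsettled) }
        where
        open Merge st c τ R A (τ e) (all-but-head (kind e)) e
        hi≢A : c (hi e) ≢ A
        hi≢A z = A≢R (trans (sym z) q)
        lo≢R : c (lo e) ≢ R
        lo≢R z = A≢R (trans (sym p) z)
        R≡A : level R ≡ level A
        R≡A with sloped e-fresh
        ... | inner eq = ⊥-elim (hi≢A (trans (sym eq) p))
        ... | hang x _ = ⊥-elim (A≢B (trans (sym p) x))
        ... | flat _ y = trans (cong level (sym q)) (trans y (cong level p))
        ... | rise _ y = ⊥-elim (<⇒≱ (≤-reflexive (trans (cong (suc ∘ level) (sym p)) (trans (sym y) (cong level q)))) R≤A)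
        same-level : ∀ {v} → c v ≡ A → level (c′ v) ≡ level (c v)
        same-level a = trans (cong level (moved′ a)) (trans R≡A (cong level (sym a)))
        keep-slope : ∀ {f σ} → Fresh (st f) → At c τ A f σ → σ ∉ all-but-head (kind e) →
                     c′ (lo f) ≢ c′ (hi f) → Sloped c′ τ′ f
        keep-slope fr (tailAt _ _ r) ∉ _ = ⊥-elim (head≢tail (sym (trans r (∉all-but-head ∉))))
        keep-slope fr (headAt a b r) ∉ _ with sloped fr
        ... | inner eq = ⊥-elim (b (trans eq a))
        ... | rise x y = rise (trans (τ′-kept b) x)
                           (trans (same-level a) (trans y (cong (suc ∘ level) (sym (kept′ b)))))
        ... | flat x y = flat (trans (τ′-kept b) x)
                           (trans (same-level a) (trans y (cong level (sym (kept′ b)))))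
        ... | hang x y = hang (trans (kept′ b) x) (trans (cong suc (same-level a)) y)
        joined-e : c′ (lo e) ≡ c′ (hi e)
        joined-e = trans (moved′ p) (sym (trans (kept′ hi≢A) q))
        keep-unique : ∀ {f g σ ρ} → R ≢ B → Fresh (st f) → Fresh (st g) →
                      At c τ R f ρ → At c′ τ′ R f ρ →
                      At c τ A g σ → At c′ τ′ R g ρ → σ ∉ all-but-head (kind e) → f ≡ g
        keep-unique _ ff fg a a′ (tailAt _ _ r) b′ ∉ = ⊥-elim (head≢tail (sym (trans r (∉all-but-head ∉))))
        keep-unique _ ff fg a a′ (headAt x _ _) (tailAt _ y _) ∉ = ⊥-elim (y (moved′ x))
        -- The kept exit enters through an edge of the same kind as `e`, so a competing exit of `R`
        -- would have to be `e`, which no longer crosses.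
        keep-unique _ ff fg a a′ (headAt _ _ s) (headAt _ _ r) ∉
          with unique R≢B (inj₁ ff) (inj₁ e-fresh) a
                 (headAt q lo≢R (trans (sym (trans s (∉all-but-head ∉))) r))
        ... | refl = ⊥-elim (at-crossing a′ joined-e)
        open Correct L e-unsettled R-label A≢R A≢B source-ok (inj₂ (p , q))
          (lose (tail∈all-but-head _) (tailAt p hi≢A refl)) three
          keep-slope (λ ∉ ∉′ → trans (∉all-but-head ∉) (sym (∉all-but-head ∉′))) keep-unique

      -- A fresh edge at the bottom leads to a cluster of level `n - 1`, so the flat exit of `A`
      -- becomes a hanging exit. An edge into the bottom rises, so `e` is never in the slot kept.
      merge-sink : R ≡ B → Ends → Step st c τ R A e
      merge-sink R≡B ends = record
        { t = false ; drops = all-but-flat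
        ; layout = layout′ ; advances = advance fewer cheap (update-owner e-unsettled) }
        where
        open Merge st c τ R A false all-but-flat e
        e-dropped : Dropped e
        e-dropped = [ (λ (p , q) → lose (head∈all-but-flat _) (headAt q (λ z → A≢R (trans (sym z) p)) refl))
                    , (λ (p , q) → here (tailAt p (λ z → A≢R (trans (sym z) q))
                        (cong tail (proj₂ (under-sink L (sloped e-fresh)
                          (λ z → A≢R (trans (sym p) (trans z q))) (trans q R≡B)))))) ]′ ends
        below-sink : suc (level A) ≡ n
        below-sink =
          [ (λ (p , q) → trans (cong (suc ∘ level) (sym q)) (over-sink L (sloped e-fresh)
              (λ z → A≢R (trans (sym q) (trans (sym z) p))) (trans p R≡B)))
          , (λ (p , q) → trans (cong (suc ∘ level) (sym p)) (proj₁ (under-sink L (sloped e-fresh)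
              (λ z → A≢R (trans (sym p) (trans z q))) (trans q R≡B)))) ]′ ends
        keep-slope : ∀ {f σ} → Fresh (st f) → At c τ A f σ → σ ∉ all-but-flat →
                     c′ (lo f) ≢ c′ (hi f) → Sloped c′ τ′ f
        keep-slope fr (headAt _ _ r) ∉ _ = ⊥-elim (head≢tail (trans r (∉all-but-flat ∉)))
        keep-slope fr (tailAt a b r) ∉ _ with trans r (∉all-but-flat ∉) | sloped fr
        ... | r′ | inner eq = ⊥-elim (b (trans (sym eq) a))
        ... | r′ | hang x _ = ⊥-elim (A≢B (trans (sym a) x))
        ... | r′ | rise x _ = ⊥-elim (true≢false (trans (cong tail (sym x)) r′))
        ... | r′ | flat _ y = hang (trans (moved′ a) R≡B)
                (trans (cong (suc ∘ level) (kept′ b)) (trans (cong suc (trans y (cong level a))) below-sink))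
        open Correct L e-unsettled R-label A≢R A≢B source-ok ends e-dropped three
          keep-slope (λ ∉ ∉′ → trans (∉all-but-flat ∉) (sym (∉all-but-flat ∉′)))
          (λ R≢B _ _ _ _ _ _ _ → ⊥-elim (R≢B R≡B))

  -- The order of the merges

  record Outcome (st₀ : E → Status) : Set where
    constructor outcome
    field
      {st}     : E → Status
      {c}      : V → V
      {τ}      : E → Bool
      {R}      : V
      layout   : Layout st c τ R
      settled  : ∀ f → ¬ Unsettled (st f)
      cheap    : value st ≤ value st₀
      faithful : ∀ f → owner (st f) ≡ owner (st₀ f)

  after : ∀ {st st′} → Advance st st′ → Outcome st′ → Outcome st
  after (advance _ ch fa) (outcome L s ch′ fa′) =
    outcome L s (≤-trans ch′ ch) (λ f → trans (fa′ f) (fa f))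

  none-left : ∀ {st} → unsettled# st ≤ 0 → ∀ f → ¬ Unsettled (st f)
  none-left {st} z f u = 1+n≰n (≤-trans (⟦⟧-yes (unsettled? (st f)) u)
    (≤-trans (sum-∈ (λ f → ⟦ unsettled? (st f) ⟧) (∈edges f)) z))

  unsettled-cases : ∀ {s} → Unsettled s → s ≡ pending ⊎ s ≡ owed
  unsettled-cases pending = inj₁ refl
  unsettled-cases owed    = inj₂ refl

  Above : (V → V) → V → V → Set
  Above c R v = c v ≢ B × level R ≤ level (c v)

  BothEnds : (V → Set) → E → Set
  BothEnds P f = P (lo f) × P (hi f)

  Incident : (V → V) → V → E → Set
  Incident c R f = c (lo f) ≡ R ⊎ c (hi f) ≡ R

  UnsettledAt : (E → Status) → (V → V) → V → E → Set
  UnsettledAt st c R f = Unsettled (st f) × Incident c R f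

  unsettled-at? : ∀ st c R → Decidable (UnsettledAt st c R)
  unsettled-at? st c R f = unsettled? (st f) ×-dec (c (lo f) ≟ R ⊎-dec c (hi f) ≟ R)

  no-owed : ∀ {st c τ R} → Layout st c τ R → (∀ f → ¬ UnsettledAt st c R f) →
            ∀ f → st f ≢ owed
  no-owed L none f o = none f (subst Unsettled (sym o) owed , Layout.credited L o)

  merge-above : ∀ {st c τ R} (L : Layout st c τ R) →
                (∀ {f} → Unsettled (st f) → BothEnds (Above c R) f) →
                ∀ {e} → Unsettled (st e) → Incident c R e → c (lo e) ≢ c (hi e) →
                ∃[ A ] A ≢ B × Step st c τ R A e
  merge-above {st} {c} {τ} {R} L above {e} u inc cross = go (above u) inc (unsettled-cases u)
    where
    go : BothEnds (Above c R) e → Incident c R e → st e ≡ pending ⊎ st e ≡ owed →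
         ∃[ A ] A ≢ B × Step st c τ R A e
    go ((lo≢B , _) , (hi≢B , le)) (inj₁ p) s = c (hi e) , hi≢B ,
      [ (λ pn → merge-up pn (λ z → lo≢B (trans p z)) p refl) , (λ o → merge-owed o (inj₁ (p , refl))) ]′ s
      where open Merging L (c (hi e)) e (lo e , p) (λ z → cross (trans p (sym z))) hi≢B
              (λ z → n≤0⇒n≡0 (≤-trans le (≤-reflexive z)))
    go ((lo≢B , le) , (hi≢B , _)) (inj₂ q) s = c (lo e) , lo≢B ,
      [ (λ pn → merge-down pn (λ z → hi≢B (trans q z)) le refl q) , (λ o → merge-owed o (inj₂ (refl , q))) ]′ s
      where open Merging L (c (lo e)) e (hi e , q) (λ z → cross (trans z (sym q))) lo≢B
              (λ z → n≤0⇒n≡0 (≤-trans le (≤-reflexive z)))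

  -- Among the unsettled edges, one whose lower end has least level supplies the root. All unsettled
  -- ends are then at least as high in level, which gives both `source-ok` and the hypothesis of
  -- `merge-down`.
  lowest : ∀ {st c τ R} → Layout st c τ R → (∀ {f} → Unsettled (st f) → BothEnds (λ v → c v ≢ B) f) →
           ∀ {e} → Unsettled (st e) →
           ∃[ R′ ] ∃[ f ] Unsettled (st f) × Incident c R′ f ×
             (∀ {g} → Unsettled (st g) → BothEnds (Above c R′) g)
  lowest {st} {c} L off {e} u = pick (⊓-sel (level (c (lo m))) (level (c (hi m))))
    where
    height : E → ℕ
    height f = level (c (lo f)) ⊓ level (c (hi f))
    candidates : List E
    candidates = filter (unsettled? ∘ st) edges
    m : E
    m = argmin height e candidates
    m-unsettled : Unsettled (st m)
    m-unsettled = argmin-all height {P = Unsettled ∘ st} u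
      (All.tabulate λ f∈ → proj₂ (∈-filter⁻ (unsettled? ∘ st) {xs = edges} f∈))
    minimal : ∀ {g} → Unsettled (st g) → height m ≤ height g
    minimal {g} ug = All.lookup (f[argmin]≤f[xs] {f = height} e candidates) (∈-filter⁺ (unsettled? ∘ st) (∈edges g) ug)
    above : ∀ {R′} → height m ≡ level R′ → ∀ {g} → Unsettled (st g) → BothEnds (Above c R′) g
    above eq {g} ug = let l , h = off ug in
      (l , ≤-trans (≤-reflexive (sym eq)) (≤-trans (minimal ug) (m⊓n≤m _ _))) ,
      (h , ≤-trans (≤-reflexive (sym eq)) (≤-trans (minimal ug) (m⊓n≤n (level (c (lo g))) _)))
    pick : height m ≡ level (c (lo m)) ⊎ height m ≡ level (c (hi m)) → _
    pick (inj₁ eq) = _ , m , m-unsettled , inj₁ refl , λ {g} → above eq {g}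
    pick (inj₂ eq) = _ , m , m-unsettled , inj₂ refl , λ {g} → above eq {g}

  -- The recursion is on a bound `k` for the number of unsettled edges. `grow` treats an unsettled
  -- edge at `R`, `continue` looks for one, and `choose` passes to a new root when none is left; by
  -- `credited` nothing is owed at that moment.
  mutual
    grow : ∀ k {st c τ R} → Layout st c τ R → (∀ {f} → Unsettled (st f) → BothEnds (Above c R) f) →
           ∀ {e} → Unsettled (st e) → Incident c R e → unsettled# st ≤ k → Outcome st
    grow zero L above u inc b = ⊥-elim (none-left b _ u)
    grow (suc k) {st} {c} {τ} {R} L above {e} u inc b with c (lo e) ≟ c (hi e)
    ... | yes eq = after advances (continue k layout (above ∘ update-unsettled)
                                     (s≤s⁻¹ (≤-trans (Advance.fewer advances) b)))
      where open Settle {st} {c} {τ} L e u eq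
    ... | no cross with merge-above L above u inc cross
    ...   | A , A≢B , S = after advances (continue k layout above′ (s≤s⁻¹ (≤-trans (Advance.fewer advances) b)))
      where
      open Step S
      R≢B : R ≢ B
      R≢B z = [ (λ p → proj₁ (proj₁ (above u)) (trans p z))
              , (λ p → proj₁ (proj₂ (above u)) (trans p z)) ]′ inc
      lift : ∀ {v} → Above c R v → Above c′ R v
      lift {v} a with c′ v | relabel-view _≟_ c A R v
      ... | _ | moved _ = R≢B , ≤-refl
      ... | _ | kept _  = a
      above′ : ∀ {f} → Unsettled (update f) → BothEnds (Above c′ R) f
      above′ uf = let l , h = above (update-unsettled uf) in lift l , lift h

    continue : ∀ k {st c τ R} → Layout st c τ R → (∀ {f} → Unsettled (st f) → BothEnds (Above c R) f) →
               unsettled# st ≤ k → Outcome st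
    continue k {st} {c} {τ} {R} L above b with search {UnsettledAt st c R} (unsettled-at? st c R)
    ... | inj₁ (e , u , inc) = grow k L above u inc b
    ... | inj₂ none = choose k L (no-owed L none) (λ u → let l , h = above u in proj₁ l , proj₁ h) b

    choose : ∀ k {st c τ R} → Layout st c τ R → (∀ f → st f ≢ owed) →
             (∀ {f} → Unsettled (st f) → BothEnds (λ v → c v ≢ B) f) → unsettled# st ≤ k → Outcome st
    choose k {st} L no-o off b with search (unsettled? ∘ st)
    ... | inj₂ none    = outcome L none ≤-refl (λ _ → refl)
    ... | inj₁ (e , u) = let _ , _ , um , inc , above = lowest L off u in
                         grow k (transfer id id (no-o _) L) above um inc b

  -- The cluster of the bottom

  module SinkPhase (q : ℕ) (q<n : q < n) where

    -- With k edges left to settle, n - level ℓ is at most 1 plus the number q - k of those settled.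
    Near : ℕ → V → Set
    Near k ℓ = n + k ≤ suc (level ℓ) + q

    near-less : ∀ {k ℓ} → Near (suc k) ℓ → Near k ℓ
    near-less {k} = ≤-trans (+-monoʳ-≤ n (n≤1+n k))

    near-B : ∀ {k ℓ} → k ≤ q → ℓ ≡ B → Near k ℓ
    near-B k≤q p = +-mono-≤ (≤-trans (≤-reflexive (sym (trans (cong level p) level-B))) (n≤1+n _)) k≤q

    near-below : ∀ {k A} → k ≤ q → suc (level A) ≡ n → Near k A
    near-below k≤q eq = ≤-trans (+-monoʳ-≤ n k≤q) (≤-reflexive (cong (_+ q) (sym eq)))

    -- Here `q < n` enters: while an edge is left to settle, fewer than `n - 1` levels have been
    -- lost. This gives `source-ok` for merges into the bottom.
    near-positive : ∀ {k A} → Near (suc k) A → level A ≢ 0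
    near-positive {k} near z = 1+n≰n (begin
      suc n        ≤⟨ s≤s (m≤m+n n k) ⟩
      suc (n + k)  ≡⟨ +-suc n k ⟨
      n + suc k    ≤⟨ near ⟩
      suc _ + q    ≡⟨ cong (λ l → suc l + q) z ⟩
      suc q        ≤⟨ q<n ⟩
      n            ∎)
      where open ≤-Reasoning

    -- A pending edge still has a slope, which puts its other end at level `n - 1`. An owed edge has
    -- no guaranteed slope, and its ends are controlled by the invariant `near` instead.
    merge-sink-near : ∀ {st c τ k} (L : Layout st c τ B) →
                      (∀ {f} → st f ≡ owed → BothEnds (Near (suc k) ∘ c) f) → suc k ≤ q →
                      ∀ {e} → Unsettled (st e) → Incident c B e → c (lo e) ≢ c (hi e) →
                      ∃[ A ] A ≢ B × Near (suc k) A × Step st c τ B A e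
    merge-sink-near {st} {c} {τ} {k} L near k≤q {e} u inc cross = go inc (unsettled-cases u)
      where
      open Layout L
      slope : st e ≡ pending → Sloped c τ e
      slope pn = sloped (subst Fresh (sym pn) pending)
      near-hi : c (lo e) ≡ B → st e ≡ pending ⊎ st e ≡ owed → Near (suc k) (c (hi e))
      near-hi p (inj₁ pn) = near-below {A = c (hi e)} k≤q (over-sink L (slope pn) cross p)
      near-hi p (inj₂ o)  = proj₂ (near o)
      near-lo : c (hi e) ≡ B → st e ≡ pending ⊎ st e ≡ owed → Near (suc k) (c (lo e))
      near-lo p (inj₁ pn) = near-below {A = c (lo e)} k≤q (proj₁ (under-sink L (slope pn) cross p))
      near-lo p (inj₂ o)  = proj₁ (near o)
      go : Incident c B e → st e ≡ pending ⊎ st e ≡ owed →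
           ∃[ A ] A ≢ B × Near (suc k) A × Step st c τ B A e
      go (inj₁ p) s = c (hi e) , A≢B , near-hi p s ,
        [ (λ pn → merge-sink pn refl (inj₁ (p , refl))) , (λ o → merge-owed o (inj₁ (p , refl))) ]′ s
        where
        A≢B : c (hi e) ≢ B
        A≢B z = cross (trans p (sym z))
        open Merging L (c (hi e)) e (lo e , p) A≢B A≢B
              (λ z → ⊥-elim (near-positive {A = c (hi e)} (near-hi p s) z))
      go (inj₂ p) s = c (lo e) , A≢B , near-lo p s ,
        [ (λ pn → merge-sink pn refl (inj₂ (refl , p))) , (λ o → merge-owed o (inj₂ (refl , p))) ]′ s
        where
        A≢B : c (lo e) ≢ B
        A≢B z = cross (trans z (sym p))
        open Merging L (c (lo e)) e (hi e , p) A≢B A≢B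
              (λ z → ⊥-elim (near-positive {A = c (lo e)} (near-lo p s) z))

    -- Fresh exits change the level by at most one, except hanging ones, and these start in the
    -- bottom.
    descend : ∀ {st c τ R A f σ} → Layout st c τ R → A ≢ B → Sloped c τ f → At c τ A f σ →
              BothEnds (λ v → c v ≡ B ⊎ level A ≤ suc (level (c v))) f
    descend L A≢B slope (tailAt p b _) = inj₂ (≤-trans (≤-reflexive (cong level (sym p))) (n≤1+n _)) , go slope
      where
      go : Sloped _ _ _ → _
      go (inner eq) = ⊥-elim (b (trans (sym eq) p))
      go (rise _ y) = inj₂ (≤-trans (≤-trans (≤-trans (≤-reflexive (cong level (sym p))) (n≤1+n _)) (≤-reflexive (sym y))) (n≤1+n _))
      go (flat _ y) = inj₂ (≤-trans (≤-reflexive (trans (cong level (sym p)) (sym y))) (n≤1+n _))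
      go (hang x _) = ⊥-elim (A≢B (trans (sym p) x))
    descend L A≢B slope (headAt p b _) = go slope , inj₂ (≤-trans (≤-reflexive (cong level (sym p))) (n≤1+n _))
      where
      go : Sloped _ _ _ → _
      go (inner eq) = ⊥-elim (b (trans eq p))
      go (rise _ y) = inj₂ (≤-reflexive (trans (cong level (sym p)) y))
      go (flat _ y) = inj₂ (≤-trans (≤-reflexive (trans (cong level (sym p)) y)) (n≤1+n _))
      go (hang x _) = inj₁ x

    -- Once no unsettled edge touches the bottom, the remaining ones avoid it for good, since later
    -- merges only join clusters other than the bottom.
    drain : ∀ k {st c τ} → Layout st c τ B → (∀ {f} → st f ≡ owed → BothEnds (Near k ∘ c) f) →
            k ≤ q → unsettled# st ≤ k → Outcome st
    drain k {st} {c} L near k≤q b with search {UnsettledAt st c B} (unsettled-at? st c B)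
    drain k {st} {c} L near k≤q b | inj₂ none =
      choose k L (no-owed L none) (λ u → (λ p → none _ (u , inj₁ p)) , (λ p → none _ (u , inj₂ p))) b
    drain zero L near k≤q b | inj₁ (e , u , inc) = ⊥-elim (none-left b e u)
    drain (suc k) {st} {c} {τ} L near k≤q b | inj₁ (e , u , inc) with c (lo e) ≟ c (hi e)
    ... | yes eq = after advances (drain k layout
                     (λ {f} o → let l , h = near (still-owed {f} o) in near-less l , near-less h)
                     (<⇒≤ k≤q) (s≤s⁻¹ (≤-trans (Advance.fewer advances) b)))
      where open Settle {st} {c} {τ} L e u eq
    ... | no cross with merge-sink-near L near k≤q u inc cross
    ...   | A , A≢B , nearA , S = after advances (drain k layout near′ (<⇒≤ k≤q) (s≤s⁻¹ (≤-trans (Advance.fewer advances) b)))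
      where
      open Step S
      lift : ∀ {v} → Near k (c v) → Near k (c′ v)
      lift {v} a with c′ v | relabel-view _≟_ c A B v
      ... | _ | moved _ = near-B (<⇒≤ k≤q) refl
      ... | _ | kept _  = a
      step : ∀ {v} → c v ≡ B ⊎ level A ≤ suc (level (c v)) → Near k (c v)
      step (inj₁ p) = near-B (<⇒≤ k≤q) p
      -- The level that may be lost on passing from `A` to its neighbour is paid for by the edge
      -- just settled.
      step (inj₂ le) = s≤s⁻¹ (≤-trans (≤-reflexive (sym (+-suc n k))) (≤-trans nearA (s≤s (+-monoˡ-≤ q le))))
      near′ : ∀ {f} → update f ≡ owed → BothEnds (Near k ∘ c′) f
      near′ {f} o with update-owed o
      ... | inj₁ s = let l , h = near s in lift {lo f} (near-less l) , lift {hi f} (near-less h)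
      ... | inj₂ (fr , d) =
        let _ , _ , a = find d
            l , h = descend L A≢B (Layout.sloped L fr) a
        in lift {lo f} (step l) , lift {hi f} (step h)

  -- From the reply to the board

  status : Owner → Status
  status free    = unclaimed
  status maker   = made
  status breaker = cut

  status-fresh : ∀ {o} → Fresh (status o) → o ≡ free
  status-fresh {free} _ = refl

  status-cut : ∀ {o} → status o ≡ cut → o ≡ breaker
  status-cut {breaker} _ = refl

  status-owed : ∀ {o} → status o ≢ owed
  status-owed {free} ()
  status-owed {maker} ()
  status-owed {breaker} ()

  -- Between turns nothing is pending or owed, so the growing cluster `B` is a placeholder.
  Secure : (E → Owner) → Set
  Secure s = ∃[ c ] ∃[ τ ] Layout (status ∘ s) c τ B

  data MakerExtends (s s′ : E → Owner) (f : E) : Set where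
    unchanged : s′ f ≡ s f → MakerExtends s s′ f
    taken     : s′ f ≡ maker → MakerExtends s s′ f

  -- `secures` allows further edges to go to Maker, because a legal move may force her to claim more
  -- than the reply asks for.
  record Defended (p : ℕ) (s : E → Owner) : Set where
    field
      claims  : List E
      claims! : Unique claims
      legal   : All (λ f → s f ≡ free) claims
      enough  : length claims ≤ p
      secures : ∀ s′ → (∀ {f} → f ∈ claims → s′ f ≡ maker) → (∀ f → MakerExtends s s′ f) → Secure s′

  length-filter-≤ : ∀ {P : E → Set} (P? : Decidable P) (w : E → ℕ) → (∀ {f} → P f → 1 ≤ w f) →
                    ∀ fs → length (filter P? fs) ≤ sum (map w fs)
  length-filter-≤ P? w 1≤w []       = z≤n
  length-filter-≤ P? w 1≤w (f ∷ fs) with P? f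
  ... | yes p = +-mono-≤ (1≤w p) (length-filter-≤ P? w 1≤w fs)
  ... | no _  = m≤n⇒m≤o+n (w f) (length-filter-≤ P? w 1≤w fs)

  chosen? : ∀ s → Dec (s ≡ chosen)
  chosen? chosen    = yes refl
  chosen? unclaimed = no λ ()
  chosen? made      = no λ ()
  chosen? cut       = no λ ()
  chosen? pending   = no λ ()
  chosen? owed      = no λ ()

  chosen-worth : ∀ {s} → s ≡ chosen → 1 ≤ worth s
  chosen-worth refl = s≤s z≤n

  owner-breaker : ∀ {s} → ¬ Unsettled s → owner s ≡ breaker → s ≡ cut
  owner-breaker {cut}     _ _ = refl
  owner-breaker {pending} ¬u _ = ⊥-elim (¬u pending)
  owner-breaker {owed}    ¬u _ = ⊥-elim (¬u owed)

  owner-free : ∀ {s} → s ≢ chosen → owner s ≡ free → Fresh s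
  owner-free {unclaimed} _ _ = unclaimed
  owner-free {chosen}   ¬c _ = ⊥-elim (¬c refl)

  -- The chosen edges are worth at least one each, so the value bounds their number. Once they are
  -- Maker's, every edge still free is fresh in the final layout, and every edge of Breaker is cut.
  outcome-defends : ∀ {st s} p → (∀ f → owner (st f) ≡ s f) → value st ≤ p → Outcome st → Defended p s
  outcome-defends {s = s} p fa₀ v≤p (outcome {st} {c} {τ} {R} L settled cheap faithful) = record
    { claims = filter (chosen? ∘ st) edges
    ; claims! = Unique.filter⁺ (chosen? ∘ st) edges!
    ; legal = All.tabulate λ {f} f∈ → trans (sym (fa f)) (cong owner (proj₂ (∈-filter⁻ (chosen? ∘ st) {xs = edges} f∈)))
    ; enough = ≤-trans (length-filter-≤ (chosen? ∘ st) (worth ∘ st) chosen-worth edges) (≤-trans cheap v≤p)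
    ; secures = λ s′ all ext → c , τ , transfer (still-cut s′ all ext) (still-fresh s′ all ext) status-owed L }
    where
    fa : ∀ f → owner (st f) ≡ s f
    fa f = trans (faithful f) (fa₀ f)
    module _ (s′ : E → Owner) (all : ∀ {f} → f ∈ filter (chosen? ∘ st) edges → s′ f ≡ maker)
             (ext : ∀ f → MakerExtends s s′ f) where
      still-cut : ∀ {f} → status (s′ f) ≡ cut → st f ≡ cut
      still-cut {f} k with ext f
      ... | unchanged eq = owner-breaker (settled f) (trans (fa f) (trans (sym eq) (status-cut k)))
      ... | taken eq with () ← trans (sym eq) (status-cut k)
      still-fresh : ∀ {f} → Fresh (status (s′ f)) → Fresh (st f)
      still-fresh {f} k with ext f
      ... | unchanged eq = owner-free
              (λ ch → case (trans (sym (status-fresh k)) (all (∈-filter⁺ (chosen? ∘ st) (∈edges f) ch))))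
              (trans (fa f) (trans (sym eq) (status-fresh k)))
        where case : free ≢ maker
              case ()
      ... | taken eq with () ← trans (sym eq) (status-fresh k)

  -- The new edges start as pending, so the initial value is at most `2 * q`, and settling never
  -- raises it. The sink phase starts with `k = q` and nothing owed.
  respond : ∀ {p q s s′} → q < n → 2 * q ≤ p → Secure s →
            ∀ bs → length bs ≤ q → All (λ f → s f ≡ free) bs →
            (∀ {f} → f ∈ bs → s′ f ≡ breaker) → (∀ {f} → f ∉ bs → s′ f ≡ s f) → Defended p s′
  respond {p} {q} {s} {s′} q<n 2q≤p (c , τ , L) bs bs≤q bs-free in-bs off-bs =
    outcome-defends p faithful (≤-trans value≤ 2q≤p)
      (SinkPhase.drain q q<n q (transfer still-cut still-fresh never-owed L)
        (λ o → ⊥-elim (never-owed o)) ≤-refl unsettled≤)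
    where
    ∈bs? : Decidable (λ f → Any (f ≡_) bs)
    ∈bs? f = any? (f ≟E_) bs

    data Begun (f : E) : Status → Set where
      hit    : f ∈ bs → Begun f pending
      missed : f ∉ bs → Begun f (status (s f))

    begun : ∀ f → ∃ (Begun f)
    begun f with ∈bs? f
    ... | yes f∈ = _ , hit f∈
    ... | no f∉  = _ , missed f∉

    st : E → Status
    st = proj₁ ∘ begun

    st-view : ∀ f → Begun f (st f)
    st-view = proj₂ ∘ begun

    still-cut : ∀ {f} → st f ≡ cut → status (s f) ≡ cut
    still-cut {f} k with st f | st-view f
    ... | _ | missed _ = k

    still-fresh : ∀ {f} → Fresh (st f) → Fresh (status (s f))
    still-fresh {f} k with st f | st-view f
    -- A new edge of Breaker was free before his move, so the old layout still describes its slope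
    -- and slots.
    ... | _ | hit f∈   = subst (Fresh ∘ status) (sym (All.lookup bs-free f∈)) unclaimed
    ... | _ | missed _ = k

    never-owed : ∀ {f} → st f ≢ owed
    never-owed {f} k with st f | st-view f
    ... | _ | missed _ = status-owed k

    owner-status : ∀ o → owner (status o) ≡ o
    owner-status free    = refl
    owner-status maker   = refl
    owner-status breaker = refl

    faithful : ∀ f → owner (st f) ≡ s′ f
    faithful f with st f | st-view f
    ... | _ | hit f∈    = sym (in-bs f∈)
    ... | _ | missed f∉ = trans (owner-status (s f)) (sym (off-bs f∉))

    hits≤ : count ∈bs? edges ≤ q
    hits≤ = ≤-trans (count-any (λ b f → f ≟E b) edges! (λ { refl refl → refl }) bs) bs≤q

    status-unsettled : ∀ o → ¬ Unsettled (status o)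
    status-unsettled free ()
    status-unsettled maker ()
    status-unsettled breaker ()

    status-worth : ∀ o → worth (status o) ≡ 0
    status-worth free    = refl
    status-worth maker   = refl
    status-worth breaker = refl

    unsettled≤ : unsettled# st ≤ q
    unsettled≤ = ≤-trans (sum-mono pointwise edges) hits≤
      where
      pointwise : ∀ f → ⟦ unsettled? (st f) ⟧ ≤ ⟦ ∈bs? f ⟧
      pointwise f with st f | st-view f
      ... | _ | hit f∈   = ⟦⟧-yes (∈bs? f) f∈
      ... | _ | missed _ = ≤-trans (≤-reflexive (⟦⟧-no (unsettled? (status (s f))) (status-unsettled (s f)))) z≤n

    value≤ : value st ≤ 2 * q
    value≤ = begin
      value st                                     ≤⟨ sum-mono pointwise edges ⟩
      total (λ f → ⟦ ∈bs? f ⟧ + ⟦ ∈bs? f ⟧)        ≡⟨ sum-+ _ _ edges ⟩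
      count ∈bs? edges + count ∈bs? edges          ≤⟨ +-mono-≤ hits≤ (≤-trans hits≤ (m≤m+n q 0)) ⟩
      2 * q                                        ∎
      where
      open ≤-Reasoning
      pointwise : ∀ f → worth (st f) ≤ ⟦ ∈bs? f ⟧ + ⟦ ∈bs? f ⟧
      pointwise f with st f | st-view f
      ... | _ | hit f∈   = +-mono-≤ (⟦⟧-yes (∈bs? f) f∈) (⟦⟧-yes (∈bs? f) f∈)
      ... | _ | missed _ = ≤-trans (≤-reflexive (status-worth (s f))) z≤n

-- Crossings along a contour

_≟V_ : DecidableEquality Vertex
_≟V_ = ≡-dec _≟_ _≟_

module _ {A : Set} (_≟A_ : DecidableEquality A) {_⟶_ : A → A → Set} where

  SimplePath : A → A → Set
  SimplePath u v = Σ (List A) λ vs → List.head vs ≡ just u × List.last vs ≡ just v × Unique vs × Linked _⟶_ vs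

  shortcut : ∀ {u v} vs → u ∈ vs → List.last vs ≡ just v → Unique vs → Linked _⟶_ vs → SimplePath u v
  shortcut (_ ∷ vs)     (here refl) l u! k                = _ ∷ vs , refl , l , u! , k
  shortcut (_ ∷ w ∷ vs) (there u∈)  l (_ ∷ u!) (_ ∷ k)    = shortcut (w ∷ vs) u∈ l u! k

  -- When the new first vertex already occurs on the path, the path is cut down to start at that
  -- occurrence.
  simple-path : ∀ {u v} → Star _⟶_ u v → SimplePath u v
  simple-path {u} ε = u ∷ [] , refl , refl , [] ∷ [] , [-]
  simple-path {u} (s ◅ p) with simple-path p
  ... | w ∷ vs , refl , l , u! , k with any? (u ≟A_) (w ∷ vs)
  ...   | yes u∈ = shortcut (w ∷ vs) u∈ l u! k
  ...   | no u∉  = u ∷ w ∷ vs , refl , l , All.¬Any⇒All¬ _ u∉ ∷ u! , s ∷ k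

module _ {m n : ℕ} {S : Edge m n → Set} where

  StepIn-sym : ∀ {u v} → StepIn m n S u v → StepIn m n S v u
  StepIn-sym (e , s , j) = e , s , swap j

  -- The edges are added one by one, each merging the class of one end into that of the other.
  -- Equality of representatives is a decidable test which, for these edges, implies a walk between
  -- the vertices.
  components : ∀ {es} → All S es → ∃[ ρ ] (∀ v → Star (StepIn m n S) v (ρ v)) ×
               All (λ e → ρ (proj₁ (ends e)) ≡ ρ (proj₂ (ends e))) es
  components [] = (λ v → v) , (λ v → ε) , []
  components {e ∷ es} (s ∷ ss) with components ss
  ... | ρ , walk , eqs = ρ′ , walk′ , meet ∷ All.map (relabel-cong _≟V_ ρ (ρ u) (ρ w)) eqs
    where
    u w : Vertex
    u = proj₁ (ends e)
    w = proj₂ (ends e)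
    ρ′ : Vertex → Vertex
    ρ′ = relabel _≟V_ ρ (ρ u) (ρ w)
    meet : ρ′ u ≡ ρ′ w
    meet with ρ′ w | relabel-view _≟V_ ρ (ρ u) (ρ w) w
    ... | _ | moved _ = relabel-moved _≟V_ ρ (ρ u) (ρ w) refl
    ... | _ | kept _  = relabel-moved _≟V_ ρ (ρ u) (ρ w) refl
    walk′ : ∀ v → Star (StepIn m n S) v (ρ′ v)
    walk′ v with ρ′ v | relabel-view _≟V_ ρ (ρ u) (ρ w) v
    ... | _ | kept _   = walk v
    -- The walk goes to the representative of `u`, back to `u`, across `e` to `w`, and on to the
    -- representative of `w`.
    ... | _ | moved eq = subst (Star _ v) eq (walk v) ◅◅ reverse StepIn-sym (walk u) ◅◅
                         (e , s , inj₁ refl) ◅ walk w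

-- Parity along the contour

xorSum : (ℕ → Bool) → ℕ → Bool
xorSum g zero    = false
xorSum g (suc k) = xorSum g k xor g k

xorSum-cong : ∀ {g h} k → (∀ y → y < k → g y ≡ h y) → xorSum g k ≡ xorSum h k
xorSum-cong zero    eq = refl
xorSum-cong (suc k) eq = cong₂ _xor_ (xorSum-cong k λ y y<k → eq y (m<n⇒m<1+n y<k)) (eq k ≤-refl)

xorSum-witness : ∀ g k → xorSum g k ≡ true → ∃[ y ] y < k × g y ≡ true
xorSum-witness g (suc k) odd with g k in eq
... | true  = k , ≤-refl , eq
... | false with xorSum g k in eq′
...   | true = let y , y<k , gy = xorSum-witness g k eq′ in y , m<n⇒m<1+n y<k , gy

xorSum-telescope : ∀ (a : ℕ → Bool) k → xorSum (λ y → a y xor a (suc y)) k ≡ a 0 xor a k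
xorSum-telescope a zero = solve 1 (λ x → con false := x :+ x) refl (a 0)
  where open xor-∧-Solver
xorSum-telescope a (suc k) = trans (cong (_xor (a k xor a (suc k))) (xorSum-telescope a k))
  (solve 3 (λ x y z → (x :+ y) :+ (y :+ z) := x :+ z) refl (a 0) (a k) (a (suc k)))
  where open xor-∧-Solver

-- In the application `a` marks the faces of level 0 and `r` the vertices connected to the left
-- side; `r-hor` and `r-ver` carry `r` along the edges separating marked from unmarked faces.
module Contour (m n : ℕ) (a r : ℕ → ℕ → Bool)
  (a-top : ∀ x → a x 0 ≡ true) (a-bottom : ∀ x → a x (suc n) ≡ false)
  (r-left : ∀ y → y < suc n → r 0 y ≡ true)
  (r-hor : ∀ x y → suc x < m → y < suc n → a (suc x) y xor a (suc x) (suc y) ≡ true → r x y ≡ r (suc x) y)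
  (r-ver : ∀ x y → x < m → suc y < suc n → a x (suc y) xor a (suc x) (suc y) ≡ true → r x y ≡ r x (suc y))
  where

  -- `H x y` stands for the edge of row `y` between the columns `x - 1` and `x`, and `V x y` for the
  -- edge of column `x` between the rows `y - 1` and `y`.
  H V : ℕ → ℕ → Bool
  H x y = a x y xor a x (suc y)
  V x y = a x y xor a (suc x) y

  -- The parity of the number of contour edges between the columns x - 1 and x whose endpoint in column i satisfies r;
  -- only i = x - 1 and i = x are meaningful.
  hits : ℕ → ℕ → ℕ → Bool
  hits i x = xorSum (λ y → r i y ∧ H x y)

  ∧-swap : ∀ {b c d} → (d ≡ true → b ≡ c) → b ∧ d ≡ c ∧ d
  ∧-swap {b} {c} {true}  eq = cong (_∧ true) (eq refl)
  ∧-swap {b} {c} {false} eq = trans (∧-zeroʳ b) (sym (∧-zeroʳ c))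

  -- Every vertex lies on an even number of contour edges. Summing over the vertices of column `x`
  -- with `r` down to row `k`, the vertical contour edges above row `k` count twice, since `r`
  -- agrees at their ends; only the one below row `k` survives.
  balance : ∀ x → x < m → ∀ k → k < suc n → hits x x (suc k) xor hits x (suc x) (suc k) ≡ r x k ∧ V x (suc k)
  balance x x<m k k<n = trans
    (solve 7 (λ p q r a a′ b b′ → (p :+ r :* (a :+ a′)) :+ (q :+ r :* (b :+ b′)) := (p :+ q) :+ r :* (a :+ b) :+ r :* (a′ :+ b′))
      refl (hits x x k) (hits x (suc x) k) (r x k) (a x k) (a x (suc k)) (a (suc x) k) (a (suc x) (suc k)))
    (trans (cong (λ z → (z xor (r x k ∧ V x k)) xor (r x k ∧ V x (suc k))) (before k k<n))
      (solve 2 (λ z w → (z :+ z) :+ w := w) refl (r x k ∧ V x k) (r x k ∧ V x (suc k))))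
    where
    open xor-∧-Solver
    before : ∀ k → k < suc n → hits x x k xor hits x (suc x) k ≡ r x k ∧ V x k
    before zero    _   = sym (trans (cong₂ (λ b c → r x 0 ∧ (b xor c)) (a-top x) (a-top (suc x))) (∧-zeroʳ (r x 0)))
    before (suc k) k<n = trans (balance x x<m k (<⇒≤ k<n)) (∧-swap (r-ver x k x<m k<n))

  -- For `x = 0` the edges are imaginary ones to the left of the board, and the sum telescopes from
  -- the top face to the bottom face. From there, `balance` carries the parity across a column and
  -- `r-hor` carries it along the edges to the next.
  odd : ∀ x → x < m → hits x x (suc n) ≡ true
  odd zero x<m = trans (xorSum-cong (suc n) (λ y y<n → cong (_∧ H 0 y) (r-left y y<n)))
    (trans (xorSum-telescope (a 0) (suc n)) (cong₂ _xor_ (a-top 0) (a-bottom 0)))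
  odd (suc x) x<m = trans (sym (xorSum-cong (suc n) λ y y<n → ∧-swap (r-hor x y x<m y<n)))
    (trans (sym (xor-cancel (trans (balance x (<⇒≤ x<m) n ≤-refl)
      (trans (cong₂ (λ b c → r x n ∧ (b xor c)) (a-bottom x) (a-bottom (suc x))) (∧-zeroʳ (r x n))))))
      (odd x (<⇒≤ x<m)))
    where
    xor-cancel : ∀ {b c} → b xor c ≡ false → b ≡ c
    xor-cancel {true}  {true}  _ = refl
    xor-cancel {false} {false} _ = refl

  reaches : ∀ x → x < m → ∃[ y ] y < suc n × r x y ≡ true
  reaches x x<m = let y , y<n , eq = xorSum-witness _ (suc n) (odd x x<m) in y , y<n , left eq
    where
    left : ∀ {b c} → b ∧ c ≡ true → b ≡ true
    left {true} _ = refl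

-- The game on the grid

does-true : ∀ {P : Set} (P? : Dec P) → does P? ≡ true → P
does-true (yes p) _ = p

count-< : ∀ {A : Set} {P Q : A → Set} (P? : Decidable P) (Q? : Decidable Q) →
          (∀ {x} → P x → Q x) → ∀ {x xs} → x ∈ xs → Q x → ¬ P x → count P? xs < count Q? xs
count-< P? Q? P⇒Q {x} {_ ∷ xs} (here refl) qx ¬px =
  ≤-trans (s≤s (+-monoˡ-≤ _ (≤-reflexive (⟦⟧-no (P? x) ¬px))))
          (+-mono-≤ (⟦⟧-yes (Q? x) qx) (sum-mono (λ y → ⟦⟧-⇒ (P? y) (Q? y) P⇒Q) xs))
count-< P? Q? P⇒Q {xs = y ∷ _} (there x∈) qx ¬px =
  +-mono-≤-< (⟦⟧-⇒ (P? y) (Q? y) P⇒Q) (count-< P? Q? P⇒Q x∈ qx ¬px)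

∈-take-++ : ∀ {A : Set} {x : A} k {xs ys} → length xs ≤ k → x ∈ xs → x ∈ take k (xs ++ ys)
∈-take-++ (suc k) le      (here refl) = here refl
∈-take-++ (suc k) (s≤s le) (there x∈) = there (∈-take-++ k le x∈)

module _ {m n : ℕ} where

  ==E-sound : (e f : Edge m n) → (e ==E f) ≡ true → e ≡ f
  ==E-sound (hor x y) (hor x′ y′) eq with x Fin.≟ x′ | y Fin.≟ y′
  ... | yes refl | yes refl = refl
  ==E-sound (ver x y) (ver x′ y′) eq with x Fin.≟ x′ | y Fin.≟ y′
  ... | yes refl | yes refl = refl

  ≟-refl : ∀ {k} (i : Fin k) → ⌊ i Fin.≟ i ⌋ ≡ true
  ≟-refl i = trans (isYes≗does (i Fin.≟ i)) (dec-true (i Fin.≟ i) refl)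

  ==E-refl : (e : Edge m n) → (e ==E e) ≡ true
  ==E-refl (hor x y) = cong₂ _∧_ (≟-refl x) (≟-refl y)
  ==E-refl (ver x y) = cong₂ _∧_ (≟-refl x) (≟-refl y)

  _≟E_ : DecidableEquality (Edge m n)
  e ≟E f = map′ (==E-sound e f) (λ { refl → ==E-refl e }) ((e ==E f) Bool.≟ true)

  elemE-∈ : ∀ {e : Edge m n} {es} → e ∈ es → elemE e es ≡ true
  elemE-∈ {e} {f ∷ es} (here refl) rewrite ==E-refl e = refl
  elemE-∈ {e} {f ∷ es} (there e∈) with e ==E f
  ... | true  = refl
  ... | false = elemE-∈ e∈

  elemE-∉ : ∀ {e : Edge m n} {es} → e ∉ es → elemE e es ≡ false
  elemE-∉ {es = []} e∉ = refl
  elemE-∉ {e} {f ∷ es} e∉ with e ==E f in eq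
  ... | true  = ⊥-elim (e∉ (here (==E-sound e f eq)))
  ... | false = elemE-∉ (e∉ ∘ there)

  claim-∈ : ∀ {s : Board m n} {o e es} → e ∈ es → claim s o es e ≡ o
  claim-∈ {s} {o} {e} e∈ = cong (if_then o else s e) (elemE-∈ e∈)

  claim-∉ : ∀ {s : Board m n} {o e es} → e ∉ es → claim s o es e ≡ s e
  claim-∉ {s} {o} {e} e∉ = cong (if_then o else s e) (elemE-∉ e∉)

  _∈?_ : (e : Edge m n) (es : List (Edge m n)) → Dec (e ∈ es)
  e ∈? es = any? (e ≟E_) es

  claim-free : ∀ {s : Board m n} {o e} es → o ≢ free → claim s o es e ≡ free → e ∉ es × s e ≡ free
  claim-free {s} {o} {e} es o≢ eq with e ∈? es
  ... | yes e∈ = ⊥-elim (o≢ (trans (sym (claim-∈ {s} e∈)) eq))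
  ... | no e∉  = e∉ , trans (sym (claim-∉ {s} e∉)) eq

  edges : List (Edge m n)
  edges = cartesianProductWith hor (allFin _) (allFin _) ++ cartesianProductWith ver (allFin _) (allFin _)

  ∈edges : ∀ e → e ∈ edges
  ∈edges (hor x y) = ∈-++⁺ˡ (∈-cartesianProductWith⁺ hor (∈-allFin x) (∈-allFin y))
  ∈edges (ver x y) = ∈-++⁺ʳ (cartesianProductWith hor (allFin _) (allFin _))
                            (∈-cartesianProductWith⁺ ver (∈-allFin x) (∈-allFin y))

  edges! : Unique edges
  edges! = Unique.++⁺
    (Unique.cartesianProductWith⁺ hor (λ { refl → refl , refl }) (Unique.allFin⁺ _) (Unique.allFin⁺ _))
    (Unique.cartesianProductWith⁺ ver (λ { refl → refl , refl }) (Unique.allFin⁺ _) (Unique.allFin⁺ _))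
    λ (h , v) → disjoint (∈-cartesianProductWith⁻ hor (allFin _) (allFin _) h)
                         (∈-cartesianProductWith⁻ ver (allFin _) (allFin _) v)
    where
    disjoint : ∀ {e} → (∃[ x ] ∃[ y ] x ∈ allFin (pred m) × y ∈ allFin n × e ≡ hor x y) →
               (∃[ x ] ∃[ y ] x ∈ allFin m × y ∈ allFin (pred n) × e ≡ ver x y) → ⊥
    disjoint (_ , _ , _ , _ , refl) (_ , _ , _ , _ , ())

  -- (x , y) is the face between the columns x - 1 and x and the rows y - 1 and y, so x = 0 and x = m are beside the
  -- board and y = 0 and y = n are above and below it.
  lo hi : Edge m n → ℕ × ℕ
  lo (hor x y) = suc (toℕ x) , toℕ y
  lo (ver x y) = toℕ x , suc (toℕ y)
  hi (hor x y) = suc (toℕ x) , suc (toℕ y)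
  hi (ver x y) = suc (toℕ x) , suc (toℕ y)

  horizontal : Edge m n → Bool
  horizontal (hor _ _) = true
  horizontal (ver _ _) = false

  lo-injective : ∀ {e f} → horizontal e ≡ horizontal f → lo e ≡ lo f → e ≡ f
  lo-injective {hor x y} {hor x′ y′} _ eq =
    cong₂ hor (toℕ-injective (suc-injective (,-injectiveˡ eq))) (toℕ-injective (,-injectiveʳ eq))
  lo-injective {ver x y} {ver x′ y′} _ eq =
    cong₂ ver (toℕ-injective (,-injectiveˡ eq)) (toℕ-injective (suc-injective (,-injectiveʳ eq)))

  hi-injective : ∀ {e f} → horizontal e ≡ horizontal f → hi e ≡ hi f → e ≡ f
  hi-injective {hor x y} {hor x′ y′} _ eq =
    cong₂ hor (toℕ-injective (suc-injective (,-injectiveˡ eq))) (toℕ-injective (suc-injective (,-injectiveʳ eq)))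
  hi-injective {ver x y} {ver x′ y′} _ eq =
    cong₂ ver (toℕ-injective (suc-injective (,-injectiveˡ eq))) (toℕ-injective (suc-injective (,-injectiveʳ eq)))

-- The initial layout and the full board

module Crossing (m n : ℕ) where

  N : ℕ
  N = suc n

  bottom : ℕ × ℕ
  bottom = 0 , N

  open Response {Edge m N} _≟E_ _≟V_ edges edges! ∈edges lo hi horizontal proj₂ N bottom refl
    (λ v → proj₂ v ≡ 0) (λ v → proj₂ v ≡ N) public

  -- All faces below the board form a single cluster.
  data Pinched (v : ℕ × ℕ) : ℕ × ℕ → Set where
    sunk : N ≤ proj₂ v → Pinched v bottom
    high : proj₂ v < N → Pinched v v

  pinched : ∀ v → ∃ (Pinched v)
  pinched v with N ≤? proj₂ v
  ... | yes N≤ = bottom , sunk N≤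
  ... | no N≰  = v , high (≰⇒> N≰)

  pinch : ℕ × ℕ → ℕ × ℕ
  pinch = proj₁ ∘ pinched

  pinch-view : ∀ v → Pinched v (pinch v)
  pinch-view = proj₂ ∘ pinched

  pinch-level : ∀ v → proj₂ v ≤ N → proj₂ (pinch v) ≡ proj₂ v
  pinch-level v ≤N with pinch v | pinch-view v
  ... | _ | sunk N≤ = ≤-antisym N≤ ≤N
  ... | _ | high _  = refl

  pinch-fixed : ∀ {v ℓ} → ℓ ≢ bottom → pinch v ≡ ℓ → v ≡ ℓ
  pinch-fixed {v} ≢ eq with pinch v | pinch-view v
  ... | _ | sunk _ = ⊥-elim (≢ (sym eq))
  ... | _ | high _ = eq

  pinch-sink : ∀ {v} → proj₂ v ≡ N → pinch v ≡ bottom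
  pinch-sink {v} eq with pinch v | pinch-view v
  ... | _ | sunk _ = refl
  ... | _ | high v<N = ⊥-elim (<⇒≢ v<N eq)

  pinch-bounded : ∀ v → proj₂ (pinch v) ≤ N
  pinch-bounded v with pinch v | pinch-view v
  ... | _ | sunk _ = ≤-refl
  ... | _ | high v<N = <⇒≤ v<N

  pinch-only : ∀ v → proj₂ (pinch v) ≡ N → pinch v ≡ bottom
  pinch-only v eq with pinch v | pinch-view v
  ... | _ | sunk _ = refl
  ... | _ | high v<N = ⊥-elim (<⇒≢ v<N eq)

  -- Initially every face not below the board is its own cluster, with its row as level. Its four
  -- slots are its four sides: a horizontal edge is crossed downwards and rises, a vertical one is
  -- crossed to the right and is flat.
  empty-secure : Secure emptyBoard
  empty-secure = pinch , horizontal , record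
    { source = λ { {_ , _} refl → refl } ; sink = pinch-sink ; bounded = pinch-bounded ; only-B = pinch-only
    ; joined = λ () ; sloped = λ {f} _ → slope f ; credited = λ () ; unique = λ ℓ≢ _ _ → single ℓ≢ }
    where
    slope : ∀ f → Sloped pinch horizontal f
    slope (hor x y) = rise refl (trans (pinch-level (suc (toℕ x) , suc (toℕ y)) (toℕ<n y))
      (cong suc (sym (pinch-level (suc (toℕ x) , toℕ y) (<⇒≤ (toℕ<n y))))))
    slope (ver x y) = flat refl (trans (pinch-level (suc (toℕ x) , suc (toℕ y)) (m≤n⇒m≤1+n (toℕ<n y)))
      (sym (pinch-level (toℕ x , suc (toℕ y)) (m≤n⇒m≤1+n (toℕ<n y)))))
    single : ∀ {ℓ σ f g} → ℓ ≢ bottom → At pinch horizontal ℓ f σ → At pinch horizontal ℓ g σ → f ≡ g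
    single ℓ≢ (tailAt p _ refl) (tailAt p′ _ r) =
      lo-injective (tail-injective (sym r)) (trans (pinch-fixed ℓ≢ p) (sym (pinch-fixed ℓ≢ p′)))
      where tail-injective : ∀ {a b} → tail a ≡ tail b → a ≡ b
            tail-injective refl = refl
    single ℓ≢ (headAt p _ refl) (headAt p′ _ r) =
      hi-injective (head-injective (sym r)) (trans (pinch-fixed ℓ≢ p) (sym (pinch-fixed ℓ≢ p′)))
      where head-injective : ∀ {a b} → head a ≡ head b → a ≡ b
            head-injective refl = refl
    single ℓ≢ (tailAt _ _ refl) (headAt _ _ ())
    single ℓ≢ (headAt _ _ refl) (tailAt _ _ ())

  hor-edge : ∀ {x y} → suc x < m → y < N → ∃[ e ] lo e ≡ (suc x , y) × hi e ≡ (suc x , suc y) ×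
             ends {m} {N} e ≡ ((x , y) , (suc x , y))
  hor-edge {x} {y} x<m y<N = hor (fromℕ< x<) (fromℕ< y<N) , go (toℕ-fromℕ< x<) (toℕ-fromℕ< y<N)
    where
    x< : x < pred m
    x< = pred-mono-≤ x<m
    go : ∀ {x′ y′} → x′ ≡ x → y′ ≡ y → (suc x′ , y′) ≡ (suc x , y) × (suc x′ , suc y′) ≡ (suc x , suc y) ×
         ((x′ , y′) , (suc x′ , y′)) ≡ ((x , y) , (suc x , y))
    go refl refl = refl , refl , refl

  ver-edge : ∀ {x y} → x < m → suc y < N → ∃[ e ] lo e ≡ (x , suc y) × hi e ≡ (suc x , suc y) ×
             ends {m} {N} e ≡ ((x , y) , (x , suc y))
  ver-edge {x} {y} x<m (s≤s y<) = ver (fromℕ< x<m) (fromℕ< y<) , go (toℕ-fromℕ< x<m) (toℕ-fromℕ< y<)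
    where
    go : ∀ {x′ y′} → x′ ≡ x → y′ ≡ y → (x′ , suc y′) ≡ (x , suc y) × (suc x′ , suc y′) ≡ (suc x , suc y) ×
         ((x′ , y′) , (x′ , suc y′)) ≡ ((x , y) , (x , suc y))
    go refl refl = refl , refl , refl

  maker? : ∀ o → Dec (o ≡ maker)
  maker? maker   = yes refl
  maker? free    = no λ ()
  maker? breaker = no λ ()

  -- An edge of Breaker has both its faces in one cluster, so on a full board every edge between
  -- level 0 and a positive level is Maker's, and the parity argument applies to these edges.
  full-crossing : ∀ {s} → 1 ≤ m → Secure s → (∀ e → s e ≢ free) → HasCrossingIn m N (λ e → s e ≡ maker)
  full-crossing {s} (s≤s {n = m′} z≤n) (c , τ , L) full = crossing (reaches m′ ≤-refl)
    where
    open Layout L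
    makers : List (Edge m N)
    makers = filter (maker? ∘ s) edges
    comps = components {S = λ e → s e ≡ maker} {es = makers}
              (All.tabulate λ e∈ → proj₂ (∈-filter⁻ (maker? ∘ s) {xs = edges} e∈))
    ρ : Vertex → Vertex
    ρ = proj₁ comps
    walk : ∀ v → Star (StepIn m N (λ e → s e ≡ maker)) v (ρ v)
    walk = proj₁ (proj₂ comps)
    linked : ∀ {e u v} → s e ≡ maker → ends e ≡ (u , v) → ρ u ≡ ρ v
    linked {e} sm refl = All.lookup (proj₂ (proj₂ comps)) (∈-filter⁺ (maker? ∘ s) (∈edges e) sm)
    a : ℕ → ℕ → Bool
    a x y = does (proj₂ (c (x , y)) ≟ 0)
    left? : ∀ w → Dec (∃[ j ] w ≡ ρ (0 , toℕ {N} j))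
    left? w = anyFin? λ j → w ≟V ρ (0 , toℕ j)
    r : ℕ → ℕ → Bool
    r x y = does (left? (ρ (x , y)))
    a-top : ∀ x → a x 0 ≡ true
    a-top x = dec-true (_ ≟ 0) (source refl)
    a-bottom : ∀ x → a x N ≡ false
    a-bottom x = dec-false (_ ≟ 0) λ eq → 1+n≢0 (trans (sym (cong proj₂ (sink {x , N} refl))) eq)
    r-left : ∀ y → y < N → r 0 y ≡ true
    r-left y y<N = dec-true (left? _) (fromℕ< y<N , cong (λ z → ρ (0 , z)) (sym (toℕ-fromℕ< y<N)))
    contour-made : ∀ {e u v} → lo e ≡ u → hi e ≡ v → a (proj₁ u) (proj₂ u) xor a (proj₁ v) (proj₂ v) ≡ true → s e ≡ maker
    contour-made {e} refl refl differ with s e in eq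
    ... | maker = refl
    ... | free  = ⊥-elim (full e eq)
    ... | breaker with () ← trans (sym differ) (trans
            (cong (λ ℓ → does (proj₂ ℓ ≟ 0) xor does (proj₂ (c (hi e)) ≟ 0)) (joined {e} (cong status eq)))
            (xor-same (does (proj₂ (c (hi e)) ≟ 0))))
    same-side : ∀ {u v} → ρ u ≡ ρ v → does (left? (ρ u)) ≡ does (left? (ρ v))
    same-side = cong (λ w → does (left? w))
    r-hor : ∀ x y → suc x < m → y < N → a (suc x) y xor a (suc x) (suc y) ≡ true → r x y ≡ r (suc x) y
    r-hor x y x<m y<N differ = let e , l , h , en = hor-edge x<m y<N in same-side (linked {e} (contour-made {e} l h differ) en)
    r-ver : ∀ x y → x < m → suc y < N → a x (suc y) xor a (suc x) (suc y) ≡ true → r x y ≡ r x (suc y)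
    r-ver x y x<m y<N differ = let e , l , h , en = ver-edge x<m y<N in same-side (linked {e} (contour-made {e} l h differ) en)
    open Contour m n a r a-top a-bottom r-left r-hor r-ver using (reaches)
    crossing : ∃[ y ] y < N × r m′ y ≡ true → HasCrossingIn m N (λ e → s e ≡ maker)
    crossing (y , y<N , eq) =
      let j , meet = does-true (left? (ρ (m′ , y))) eq
          -- The two walks meet at the common representative of a left vertex and the right vertex
          -- found by `reaches`.
          vs , h , l , u! , k = simple-path _≟V_ (walk (0 , toℕ j) ◅◅
            subst (λ w → Star _ w (m′ , y)) meet (reverse StepIn-sym (walk (m′ , y))))
      in vs , toℕ j , y , toℕ<n j , y<N , h , l , u! , k

-- Playing until the board is full

module Play (m n p q : ℕ) (1≤m : 1 ≤ m) (1≤p : 1 ≤ p) (2q≤p : 2 * q ≤ p) (q<N : q < suc n) where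
  open Crossing m n

  free? : ∀ o → Dec (o ≡ free)
  free? free    = yes refl
  free? maker   = no λ ()
  free? breaker = no λ ()

  free# : Board m N → ℕ
  free# s = count (free? ∘ s) edges

  -- The reply is padded with other free edges to a legal move. It comes first in `pool` and has at
  -- most `p` edges, so `take` keeps all of it.
  complete : ∀ {s} → Defended p s → ∃[ es ] LegalMove s p es × Secure (claim s maker es)
  complete {s} D = es , (es! , es-free , es-size) , secures (claim s maker es)
    (λ e∈ → claim-∈ {s = s} (∈-take-++ p enough e∈)) extends
    where
    open Defended D
    rest pool es : List (Edge m N)
    rest = filter (λ e → ¬? (e ∈? claims)) (filter (free? ∘ s) edges)
    pool = claims ++ rest
    es   = take p pool
    rest-∈ : ∀ {e} → e ∈ rest → e ∉ claims × s e ≡ free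
    rest-∈ e∈ = let e∈′ , e∉ = ∈-filter⁻ (λ e → ¬? (e ∈? claims)) {xs = filter (free? ∘ s) edges} e∈
                in e∉ , proj₂ (∈-filter⁻ (free? ∘ s) {xs = edges} e∈′)
    es! : Unique es
    es! = Unique.take⁺ p (Unique.++⁺ claims!
      (Unique.filter⁺ (λ e → ¬? (e ∈? claims)) (Unique.filter⁺ (free? ∘ s) edges!)) λ (l , r) → proj₁ (rest-∈ r) l)
    es-free : All (λ e → s e ≡ free) es
    es-free = All.take⁺ p (All.++⁺ legal (All.tabulate (proj₂ ∘ rest-∈)))
    pool-∋ : ∀ e → s e ≡ free → e ∈ pool
    pool-∋ e fr with e ∈? claims
    ... | yes e∈ = ∈-++⁺ˡ e∈
    ... | no e∉  = ∈-++⁺ʳ claims (∈-filter⁺ (λ e → ¬? (e ∈? claims)) (∈-filter⁺ (free? ∘ s) (∈edges e) fr) e∉)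
    es-size : length es ≡ p ⊎ (length es < p × (∀ e → s e ≡ free → e ∈ es))
    es-size with p ≤? length pool
    ... | yes p≤ = inj₁ (trans (length-take p pool) (m≤n⇒m⊓n≡m p≤))
    ... | no p≰  = inj₂ (subst (λ xs → length xs < p × (∀ e → s e ≡ free → e ∈ xs))
                     (sym (take-all p pool (<⇒≤ (≰⇒> p≰)))) (≰⇒> p≰ , pool-∋))
    extends : ∀ e → MakerExtends s (claim s maker es) e
    extends e with e ∈? es
    ... | yes e∈ = taken (claim-∈ {s = s} e∈)
    ... | no e∉  = unchanged (claim-∉ {s = s} e∉)

  member : ∀ {s : Board m N} {es e} → LegalMove s p es → s e ≡ free → ∃[ f ] f ∈ es
  member {es = f ∷ _} _ _ = f , here refl
  member {es = []} (_ , _ , inj₁ 0≡p) _ = ⊥-elim (<⇒≢ 1≤p 0≡p)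
  member {es = []} (_ , _ , inj₂ (_ , all)) fr with () ← all _ fr

  legal-size : ∀ {s : Board m N} {k es} → LegalMove s k es → length es ≤ k
  legal-size (_ , _ , inj₁ eq)       = ≤-reflexive eq
  legal-size (_ , _ , inj₂ (lt , _)) = <⇒≤ lt

  -- The recursion is on the number of free edges: as `p` is positive, each turn of Maker uses one
  -- up. On a full board the crossing is already there.
  wins : ∀ k {s} → Defended p s → free# s ≤ k → MakerWins m N p q s
  wins k {s} D b with search (free? ∘ s)
  wins k {s} D b | inj₂ full = already (full-crossing 1≤m (secures s (λ e∈ → ⊥-elim (full _ (All.lookup legal e∈)))
                                 (λ e → unchanged refl)) full)
    where open Defended D
  wins zero {s} D b | inj₁ (e , fr) = ⊥-elim (1+n≰n (≤-trans (⟦⟧-yes (free? (s e)) fr)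
                                        (≤-trans (sum-∈ (λ e → ⟦ free? (s e) ⟧) (∈edges e)) b)))
  wins (suc k) {s} D b | inj₁ (e , fr) = go (complete D)
    where
    go : ∃[ es ] LegalMove s p es × Secure (claim s maker es) → MakerWins m N p q s
    go (es , lm , sec) = play es lm (inj₂ λ bs lb@(_ , bs-free , _) →
      wins k (respond q<N 2q≤p sec bs (legal-size lb) bs-free
               (λ e∈ → claim-∈ {s = claim s maker es} e∈) (λ e∉ → claim-∉ {s = claim s maker es} e∉))
             (s≤s⁻¹ (≤-trans (fewer bs) b)))
      where
      f∈ : ∃[ f ] f ∈ es
      f∈ = member lm fr
      fewer : ∀ bs → free# (claim (claim s maker es) breaker bs) < free# s
      fewer bs = count-< (free? ∘ claim (claim s maker es) breaker bs) (free? ∘ s)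
        (λ {x} eq → proj₂ (claim-free {s = s} es (λ ()) (proj₂ (claim-free {s = claim s maker es} bs (λ ()) eq))))
        (∈edges (proj₁ f∈)) (All.lookup (proj₁ (proj₂ lm)) (proj₂ f∈))
        (λ eq → proj₁ (claim-free {s = s} es (λ ()) (proj₂ (claim-free {s = claim s maker es} bs (λ ()) eq))) (proj₂ f∈))

  empty-defended : Defended p emptyBoard
  empty-defended = outcome-defends {st = λ _ → unclaimed} p (λ _ → refl) value≤ (outcome {st = λ _ → unclaimed} (proj₂ (proj₂ empty-secure)) (λ _ ()) ≤-refl λ _ → refl)
    where
    value≤ : value (λ _ → unclaimed) ≤ p
    value≤ = ≤-trans (sum-≤0 (All.universal (λ _ → refl) (edges {m} {N}))) z≤n

theorem1p1 : (m n p q : ℕ) → 1 ≤ m → 1 ≤ q → 2 * q ≤ p → q + 1 ≤ n →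
    MakerHasWinningStrategy m n p q
-- A board without rows contradicts `q + 1 ≤ n`; hence the rows number `suc n`, the `N` of the game
-- modules.
theorem1p1 m zero p q 1≤m 1≤q 2q≤p q+1≤n = ⊥-elim (n≮0 (≤-trans (≤-reflexive (+-comm 1 q)) q+1≤n))
theorem1p1 m (suc n) p q 1≤m 1≤q 2q≤p q+1≤n = wins _ empty-defended ≤-refl
  where
  open Play m n p q 1≤m (≤-trans 1≤q (≤-trans (m≤m+n q _) 2q≤p)) 2q≤p (≤-trans (≤-reflexive (+-comm 1 q)) q+1≤n)
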